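{- Let $p\in\mathbb{R}[x]$ with $p\neq 0$, and let $qs=[q_0,\dots,q_{n-1}]$ be a finite list (possibly empty) of polynomials in $\mathbb{R}[x]$ such that every $q$ in $qs$ is coprime to $p$. Then the set of entries of the list $\mathtt{find\_consistent\_signs\_at\_roots}(p,qs)$ produced by the recursive algorithm defined in the context is exactly the set of sign vectors of $qs$ realized at the real roots of $p$: $$\{\sigma : \sigma\in\mathtt{find\_consistent\_signs\_at\_roots}(p,qs)\}=\bigl\{(\mathrm{sgn}\,q_0(x),\dots,\mathrm{sgn}\,q_{n-1}(x)) : x\in\mathbb{R},\ p(x)=0\bigr\}.$$
   Context: $\mathrm{sgn}(y)\in\{ -1,0,+1\}$ is the sign of a real $y$. A sign vector for a list of $m$ polynomials is a list of $m$ elements of $\{ -1,0,1\}$. $\mathtt{find\_consistent\_signs\_at\_roots}(p,qs)$ is the third component $\Sigma$ of $\mathtt{calc\_data}(p,qs)=(M,S,\Sigma)$. Here $M$ is a rational matrix, $S$ is a list of lists of indices into $qs$ (indices start at $0$), and $\Sigma$ is a list of sign vectors. Rows of $M$ correspond to entries of $S$ and columns to entries of $\Sigma$. It is defined as follows. *Tarski query:* for polynomials $p\ne0$ and $q$, $N(p,q)=\#\{x\in\mathbb{R}: p(x)=0,\,q(x)>0\}-\#\{x\in\mathbb{R}: p(x)=0,\,q(x)<0\}$. *Base data:* $\mathtt{base}=\left(\begin{pmatrix}1&1\\1&-1\end{pmatrix},\,[[\,],[0]],\,[[1],[-1]]\right)$. *Combination:* $\mathtt{combine}((qs_1,(M_1,S_1,\Sigma_1)),(qs_2,(M_2,S_2,\Sigma_2)))=(qs,(M,S,\Sigma))$.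 Here $qs$ is the concatenation of $qs_1$ and $qs_2$, and $M$ is the Kronecker product $M_1\otimes M_2$. $S$ lists all concatenations of an entry $I$ of $S_1$ with an entry $J$ of $S_2$ whose indices have all been increased by the length of $qs_1$. $\Sigma$ lists all concatenations of an entry of $\Sigma_1$ with an entry of $\Sigma_2$. In both lists the choice from the first list is the outer loop. *Reduction:* $\mathtt{reduce}(p,(qs,(M,S,\Sigma)))$ returns a triple $(M',S',\Sigma')$. Let $v$ be the vector with entries $v_i=N(p,\prod_{k\in S_i}qs_k)$ and let $w=M^{ -1}v$ (if $M$ is not square and invertible, $w$ is some fixed default vector of the right length). Delete from $M$ the columns $j$ with $w_j=0$ and delete the corresponding entries of $\Sigma$, giving a matrix $A$ and the list $\Sigma'$. Let $R$ be the list of column indices of the pivots (first nonzero entries of the nonzero rows) of the reduced row echelon form of $A^T$. Then $M'$ consists of the rows of $A$ indexed by $R$, and $S'$ of the entries of $S$ indexed by $R$. *Recursion:* let $\ell$ be the length of $qs$. - If $\ell=0$: compute $\mathtt{reduce}(p,([1],\mathtt{base}))$, where $[1]$ is the list containing the constant polynomial $1$, and delete the first entry of each sign vector in the third component. - If $\ell=1$: $\mathtt{calc\_data}(p,qs)=\mathtt{reduce}(p,(qs,\mathtt{base}))$. - If $\ell\ge2$: let $qs_1$ be the first $\lfloor \ell/2\rfloor$ entries of $qs$ and $qs_2$ the remaining ones. Then $\mathtt{calc\_data}(p,qs)=\mathtt{reduce}(p,\mathtt{combine}((qs_1,\mathtt{calc\_data}(p,qs_1)),(qs_2,\mathtt{calc\_data}(p,qs_2))))$.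 -}

module Defs where

open import Algebra.Bundles.Raw using (RawMagma)
open import Algebra.Definitions.RawMagma using () renaming (_∣_ to Divides)
open import Algebra.Properties.CommutativeMonoid.Sum using ()
  renaming (sum to sumOf)
open import Axiom.ExcludedMiddle using (ExcludedMiddle)
open import Data.Bool.Base using (if_then_else_)
open import Data.Fin.Base as Fin using (Fin; remQuot)
import Data.Fin.Properties as Finₚ
open import Data.Integer.Base as ℤ using (ℤ)
open import Data.List.Base as List
  using (List; []; _∷_; [_]; _++_; length; lookup; take; drop; allFin)
import Data.List.Properties as Listₚ
open import Data.Maybe.Base using (Maybe; just; nothing)
open import Data.Nat.Base as ℕ using (ℕ; zero; suc; ⌊_/2⌋)
open import Data.Nat.Induction using (Acc; acc; <-wellFounded)
import Data.Nat.Properties as ℕₚ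
open import Data.Product.Base using (_×_; _,_; proj₁; proj₂; ∃; ∃-syntax)
open import Data.Rational.Base using
  (ℚ; 0ℚ; 1ℚ; ½; _+_; _-_; _*_; -_; 1/_; _/_; ∣_∣; _<_; _≤_; Positive; positive; NonZero)
open import Data.Rational.Properties as ℚₚ using (_≟_)
open import Data.Rational.Solver using (module +-*-Solver)
open import Data.Vec.Functional as Vector using (Vector; transpose)
  renaming ([] to []ᵥ; _∷_ to infixr 5 _∷ᵥ_)
open import Function.Base using (_∘_)
open import Level using (0ℓ)
open import Relation.Binary.PropositionalEquality
  using (_≡_; _≢_; refl; sym; trans; cong; subst)
open import Relation.Nullary.Decidable.Core using (yes; no; does; ¬?)

------------------------------------------------------------------------
-- Real numbers: Cauchy sequences of rationals, up to null sequences

record ℝ : Set where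
  constructor mkℝ
  field
    seq    : ℕ → ℚ
    cauchy : ∀ ε → 0ℚ < ε → ∃[ N ] ∀ m n → N ℕ.≤ m → N ℕ.≤ n →
             ∣ seq m - seq n ∣ < ε

open ℝ public

infix 4 _≃_ _<ᵣ_

_≃_ : ℝ → ℝ → Set
x ≃ y = ∀ ε → 0ℚ < ε → ∃[ N ] ∀ n → N ℕ.≤ n → ∣ seq x n - seq y n ∣ < ε

_<ᵣ_ : ℝ → ℝ → Set
x <ᵣ y = ∃[ ε ] 0ℚ < ε × ∃[ N ] ∀ n → N ℕ.≤ n → seq x n + ε < seq y n

fromℚ : ℚ → ℝ
fromℚ q = mkℝ (λ _ → q) λ ε 0<ε → 0 , λ _ _ _ _ →
  subst (_< ε) (sym (cong ∣_∣ (ℚₚ.+-inverseʳ q))) 0<ε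

0ᵣ 1ᵣ : ℝ
0ᵣ = fromℚ 0ℚ
1ᵣ = fromℚ 1ℚ

private
  half-pos : ∀ {ε} → 0ℚ < ε → 0ℚ < ½ * ε
  half-pos {ε} 0<ε = ℚₚ.positive⁻¹ (½ * ε) {{ℚₚ.pos*pos⇒pos ½ ε}}
    where instance
      pε : Positive ε
      pε = positive 0<ε

  half+half : ∀ ε → ½ * ε + ½ * ε ≡ ε
  half+half ε = trans (sym (ℚₚ.*-distribʳ-+ ε ½ ½)) (ℚₚ.*-identityˡ ε)

  max-≤ : ∀ {M N k} → M ℕ.⊔ N ℕ.≤ k → M ℕ.≤ k × N ℕ.≤ k
  max-≤ {M} {N} h = ℕₚ.≤-trans (ℕₚ.m≤m⊔n M N) h , ℕₚ.≤-trans (ℕₚ.m≤n⊔m M N) h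

  bounded : ∀ x → ∃[ B ] 0ℚ < B × ∃[ N ] ∀ n → N ℕ.≤ n → ∣ seq x n ∣ ≤ B
  bounded x with cauchy x 1ℚ (ℚₚ.positive⁻¹ 1ℚ)
  ... | N , h = 1ℚ + ∣ seq x N ∣ ,
        ℚₚ.+-mono-<-≤ {0ℚ} {1ℚ} {0ℚ} (ℚₚ.positive⁻¹ 1ℚ) (ℚₚ.0≤∣p∣ (seq x N)) ,
        N , λ n N≤n → begin
          ∣ seq x n ∣                       ≡⟨ cong ∣_∣ (split (seq x n) (seq x N)) ⟩
          ∣ (seq x n - seq x N) + seq x N ∣ ≤⟨ ℚₚ.∣p+q∣≤∣p∣+∣q∣ (seq x n - seq x N) (seq x N) ⟩
          ∣ seq x n - seq x N ∣ + ∣ seq x N ∣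
            ≤⟨ ℚₚ.+-monoˡ-≤ ∣ seq x N ∣ (ℚₚ.<⇒≤ (h n N N≤n ℕₚ.≤-refl)) ⟩
          1ℚ + ∣ seq x N ∣ ∎
    where
    open ℚₚ.≤-Reasoning
    split : ∀ a b → a ≡ (a - b) + b
    split = solve 2 (λ a b → a := (a :- b) :+ b) refl
      where open +-*-Solver

private abstract
  sum-cauchy : ∀ x y ε → 0ℚ < ε → ∃[ N ] ∀ m n → N ℕ.≤ m → N ℕ.≤ n →
               ∣ (seq x m + seq y m) - (seq x n + seq y n) ∣ < ε
  sum-cauchy x y ε 0<ε with cauchy x (½ * ε) (half-pos 0<ε) | cauchy y (½ * ε) (half-pos 0<ε)
  ... | N₁ , h₁ | N₂ , h₂ = N₁ ℕ.⊔ N₂ , λ m n N≤m N≤n → begin-strict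
    ∣ (seq x m + seq y m) - (seq x n + seq y n) ∣
      ≡⟨ cong ∣_∣ (regroup (seq x m) (seq y m) (seq x n) (seq y n)) ⟩
    ∣ (seq x m - seq x n) + (seq y m - seq y n) ∣
      ≤⟨ ℚₚ.∣p+q∣≤∣p∣+∣q∣ (seq x m - seq x n) (seq y m - seq y n) ⟩
    ∣ seq x m - seq x n ∣ + ∣ seq y m - seq y n ∣
      <⟨ ℚₚ.+-mono-< (h₁ m n (proj₁ (max-≤ N≤m)) (proj₁ (max-≤ N≤n)))
                     (h₂ m n (proj₂ (max-≤ {N₁} N≤m)) (proj₂ (max-≤ {N₁} N≤n))) ⟩
    ½ * ε + ½ * ε ≡⟨ half+half ε ⟩
    ε ∎
    where
    open ℚₚ.≤-Reasoning
    regroup : ∀ a b c d → (a + b) - (c + d) ≡ (a - c) + (b - d)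
    regroup = solve 4 (λ a b c d → (a :+ b) :- (c :+ d) := (a :- c) :+ (b :- d)) refl
      where open +-*-Solver

private abstract
  divide : ∀ D ε → 0ℚ < D → 0ℚ < ε → ∃[ δ ] 0ℚ < δ × D * δ ≡ ε
  divide D ε 0<D 0<ε = 1/ D * ε , ℚₚ.positive⁻¹ (1/ D * ε) , (begin-equality
    D * (1/ D * ε) ≡⟨ ℚₚ.*-assoc D (1/ D) ε ⟨
    D * 1/ D * ε   ≡⟨ cong (_* ε) (ℚₚ.*-inverseʳ D) ⟩
    1ℚ * ε         ≡⟨ ℚₚ.*-identityˡ ε ⟩
    ε ∎)
    where
    open ℚₚ.≤-Reasoning
    instance
      pD : Positive D
      pD = positive 0<D
      nzD : NonZero D
      nzD = ℚₚ.pos⇒nonZero D {{pD}}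
      pδ : Positive (1/ D * ε)
      pδ = ℚₚ.pos*pos⇒pos (1/ D) {{ℚₚ.1/pos⇒pos D {{pD}}}} ε {{positive 0<ε}}

  term : ∀ D δ a b → 0ℚ < D → ∣ a ∣ ≤ D → ∣ b ∣ < δ → ∣ a * b ∣ < D * δ
  term D δ a b 0<D a≤D b<δ = begin-strict
    ∣ a * b ∣     ≡⟨ ℚₚ.∣p*q∣≡∣p∣*∣q∣ a b ⟩
    ∣ a ∣ * ∣ b ∣ ≤⟨ ℚₚ.*-monoʳ-≤-nonNeg ∣ b ∣ {{ℚₚ.∣-∣-nonNeg b}} a≤D ⟩
    D * ∣ b ∣     <⟨ ℚₚ.*-monoʳ-<-pos D {{positive 0<D}} b<δ ⟩
    D * δ ∎
    where open ℚₚ.≤-Reasoning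

  product-close : ∀ {B C δ} a b c d → 0ℚ < B → 0ℚ < C →
                  ∣ a ∣ ≤ B → ∣ d ∣ ≤ C → ∣ a - c ∣ < δ → ∣ b - d ∣ < δ →
                  ∣ a * b - c * d ∣ < (B + C) * δ
  product-close {B} {C} {δ} a b c d 0<B 0<C a≤B d≤C ac bd = begin-strict
    ∣ a * b - c * d ∣                 ≡⟨ cong ∣_∣ (regroup a b c d) ⟩
    ∣ a * (b - d) + d * (a - c) ∣     ≤⟨ ℚₚ.∣p+q∣≤∣p∣+∣q∣ (a * (b - d)) (d * (a - c)) ⟩
    ∣ a * (b - d) ∣ + ∣ d * (a - c) ∣ <⟨ ℚₚ.+-mono-< (term B δ a (b - d) 0<B a≤B bd)
                                                     (term C δ d (a - c) 0<C d≤C ac) ⟩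
    B * δ + C * δ                     ≡⟨ ℚₚ.*-distribʳ-+ δ B C ⟨
    (B + C) * δ ∎
    where
    open ℚₚ.≤-Reasoning
    regroup : ∀ a b c d → a * b - c * d ≡ a * (b - d) + d * (a - c)
    regroup = solve 4 (λ a b c d → a :* b :- c :* d := a :* (b :- d) :+ d :* (a :- c)) refl
      where open +-*-Solver

  product-cauchy : ∀ x y ε → 0ℚ < ε → ∃[ N ] ∀ m n → N ℕ.≤ m → N ℕ.≤ n →
                   ∣ seq x m * seq y m - seq x n * seq y n ∣ < ε
  product-cauchy x y ε 0<ε =
    let B , 0<B , K , hB = bounded x
        C , 0<C , L , hC = bounded y
        δ , 0<δ , Dδ≡ε   = divide (B + C) ε (ℚₚ.+-mono-< 0<B 0<C) 0<ε
        N₁ , h₁          = cauchy x δ 0<δ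
        N₂ , h₂          = cauchy y δ 0<δ
    in (K ℕ.⊔ L) ℕ.⊔ (N₁ ℕ.⊔ N₂) , λ m n N≤m N≤n →
      let KL≤m , N₁₂≤m = max-≤ {K ℕ.⊔ L} N≤m
          KL≤n , N₁₂≤n = max-≤ {K ℕ.⊔ L} N≤n
          N₁≤m , N₂≤m  = max-≤ {N₁} N₁₂≤m
          N₁≤n , N₂≤n  = max-≤ {N₁} N₁₂≤n
      in subst (∣ seq x m * seq y m - seq x n * seq y n ∣ <_) Dδ≡ε
           (product-close (seq x m) (seq y m) (seq x n) (seq y n) 0<B 0<C
             (hB m (proj₁ (max-≤ {K} KL≤m))) (hC n (proj₂ (max-≤ {K} KL≤n)))
             (h₁ m n N₁≤m N₁≤n) (h₂ m n N₂≤m N₂≤n))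

infixl 6 _+ᵣ_
infixl 7 _*ᵣ_

_+ᵣ_ : ℝ → ℝ → ℝ
x +ᵣ y = mkℝ (λ n → seq x n + seq y n) (sum-cauchy x y)

_*ᵣ_ : ℝ → ℝ → ℝ
x *ᵣ y = mkℝ (λ n → seq x n * seq y n) (product-cauchy x y)

------------------------------------------------------------------------
-- ℝ[x]: coefficient lists, constant term first, up to trailing zeros

Poly : Set
Poly = List ℝ

coeff : Poly → ℕ → ℝ
coeff []      _       = 0ᵣ
coeff (a ∷ _) zero    = a
coeff (_ ∷ p) (suc k) = coeff p k

infix 4 _≈ₚ_

_≈ₚ_ : Poly → Poly → Set
p ≈ₚ q = ∀ k → coeff p k ≃ coeff q k

0ₚ 1ₚ : Poly
0ₚ = []
1ₚ = [ 1ᵣ ]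

infixl 6 _+ₚ_
infixl 7 _*ₚ_

_+ₚ_ : Poly → Poly → Poly
[]      +ₚ q       = q
(a ∷ p) +ₚ []      = a ∷ p
(a ∷ p) +ₚ (b ∷ q) = a +ᵣ b ∷ p +ₚ q

_*ₚ_ : Poly → Poly → Poly
[]      *ₚ q = []
(a ∷ p) *ₚ q = List.map (a *ᵣ_) q +ₚ (0ᵣ ∷ p *ₚ q)

productₚ : List Poly → Poly
productₚ = List.foldr _*ₚ_ 1ₚ

eval : Poly → ℝ → ℝ
eval []      x = 0ᵣ
eval (a ∷ p) x = a +ᵣ x *ᵣ eval p x

*ₚ-rawMagma : RawMagma 0ℓ 0ℓ
*ₚ-rawMagma = record { Carrier = Poly ; _≈_ = _≈ₚ_ ; _∙_ = _*ₚ_ }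

infix 4 _∣ₚ_

_∣ₚ_ : Poly → Poly → Set
_∣ₚ_ = Divides *ₚ-rawMagma

-- every common divisor is a unit
Coprime : Poly → Poly → Set
Coprime p q = ∀ d → d ∣ₚ p → d ∣ₚ q → d ∣ₚ 1ₚ

------------------------------------------------------------------------
-- Rational matrices

Matrix : ℕ → ℕ → Set
Matrix r c = Vector (Vector ℚ c) r

∑ : ∀ {n} → Vector ℚ n → ℚ
∑ = sumOf ℚₚ.+-0-commutativeMonoid

infixl 7 _*ₘ_ _*ᵥ_ _⊗_
infix  4 _≈ₘ_

_≈ₘ_ : ∀ {r c} → Matrix r c → Matrix r c → Set
A ≈ₘ B = ∀ i j → A i j ≡ B i j

_*ₘ_ : ∀ {r s c} → Matrix r s → Matrix s c → Matrix r c
(A *ₘ B) i j = ∑ λ k → A i k * B k j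

_*ᵥ_ : ∀ {r c} → Matrix r c → Vector ℚ c → Vector ℚ r
(A *ᵥ v) i = ∑ λ k → A i k * v k

identity : ∀ n → Matrix n n
identity n i j = if does (i Finₚ.≟ j) then 1ℚ else 0ℚ

_⊗_ : ∀ {r₁ c₁ r₂ c₂} → Matrix r₁ c₁ → Matrix r₂ c₂ →
      Matrix (r₁ ℕ.* r₂) (c₁ ℕ.* c₂)
_⊗_ {r₁} {c₁} {r₂} {c₂} A B i j =
  let i₁ , i₂ = remQuot {r₁} r₂ i
      j₁ , j₂ = remQuot {c₁} c₂ j
  in A i₁ j₁ * B i₂ j₂

-- The dimensions of the algorithm's matrices are lengths of computed lists,
-- so squareness is a proposition (r ≡ c) rather than a definitional equality.
IsInverse : ∀ {r c} → Matrix r c → Matrix c r → Set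
IsInverse {r} {c} A B = A *ₘ B ≈ₘ identity r × B *ₘ A ≈ₘ identity c

SquareWithInverse : ∀ {r c} → Matrix r c → Matrix c r → Set
SquareWithInverse {r} {c} A B = r ≡ c × IsInverse A B

nonzeros : ∀ {n} → Vector ℚ n → List (Fin n)
nonzeros v = List.filter (λ j → ¬? (v j ≟ 0ℚ)) (allFin _)

leading : ∀ {n} → Vector ℚ n → Maybe (Fin n)
leading v = List.head (nonzeros v)

pivots : ∀ {r c} → Matrix r c → List (Fin c)
pivots E = List.mapMaybe (λ i → leading (E i)) (allFin _)

RowEquivalent : ∀ {r c} → Matrix r c → Matrix r c → Set
RowEquivalent {r} A E =
  ∃[ P ] (∃[ Q ] IsInverse {r} {r} P Q) × E ≈ₘ P *ₘ A

record IsRREF {r c} (E : Matrix r c) : Set where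
  field
    zeroRowsLast   : ∀ {i i′} → i Fin.< i′ →
                     leading (E i) ≡ nothing → leading (E i′) ≡ nothing
    pivotsIncrease : ∀ {i i′ j j′} → i Fin.< i′ → leading (E i) ≡ just j →
                     leading (E i′) ≡ just j′ → j Fin.< j′
    pivotIsOne     : ∀ {i j} → leading (E i) ≡ just j → E i j ≡ 1ℚ
    pivotColumn    : ∀ {i j} → leading (E i) ≡ just j →
                     ∀ i′ → i′ ≢ i → E i′ j ≡ 0ℚ

------------------------------------------------------------------------
-- Sign vectors and the data (M , S , Σ)

data Sgn : Set where
  neg zer pos : Sgn

SignVector : Set
SignVector = List Sgn

record SignData : Set where
  constructor mkSignData
  field
    {rows cols} : ℕ
    M           : Matrix rows cols
    S           : Vector (List ℕ) rows
    Σ           : Vector SignVector cols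

base : SignData
base = mkSignData {2} {2}
  ((1ℚ ∷ᵥ 1ℚ ∷ᵥ []ᵥ) ∷ᵥ (1ℚ ∷ᵥ - 1ℚ ∷ᵥ []ᵥ) ∷ᵥ []ᵥ)
  ([] ∷ᵥ [ 0 ] ∷ᵥ []ᵥ)
  ([ pos ] ∷ᵥ [ neg ] ∷ᵥ []ᵥ)

combine : List Poly × SignData → List Poly × SignData → List Poly × SignData
combine (qs₁ , mkSignData {r₁} {c₁} M₁ S₁ Σ₁) (qs₂ , mkSignData {r₂} {c₂} M₂ S₂ Σ₂) =
  qs₁ ++ qs₂ , mkSignData
    (M₁ ⊗ M₂)
    (λ i → let i₁ , i₂ = remQuot {r₁} r₂ i in
           S₁ i₁ ++ List.map (length qs₁ ℕ.+_) (S₂ i₂))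
    (λ j → let j₁ , j₂ = remQuot {c₁} c₂ j in Σ₁ j₁ ++ Σ₂ j₂)

-- The value beyond the end of the list is never used by the algorithm.
nth : List Poly → ℕ → Poly
nth []       _       = 0ₚ
nth (q ∷ _)  zero    = q
nth (_ ∷ qs) (suc k) = nth qs k

IsCardinality : (ℝ → Set) → ℕ → Set
IsCardinality P n = ∃ λ (f : Fin n → ℝ) →
  (∀ i → P (f i)) ×
  (∀ i j → f i ≃ f j → i ≡ j) ×
  (∀ x → P x → ∃[ i ] x ≃ f i)

------------------------------------------------------------------------
-- The algorithm. Signs of reals and root counts are not computable, so
-- excluded middle is a parameter.

module _ (em : ExcludedMiddle 0ℓ) where

  -- Some a satisfying P if there is one, and the given fallback otherwise.
  choose : {A : Set} (P : A → Set) → A → A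
  choose P fallback with em {∃ P}
  ... | yes (a , _) = a
  ... | no  _       = fallback

  sgn : ℝ → Sgn
  sgn x with em {0ᵣ <ᵣ x} | em {x <ᵣ 0ᵣ}
  ... | yes _ | _     = pos
  ... | no  _ | yes _ = neg
  ... | no  _ | no  _ = zer

  -- 0 when P is infinite
  card : (ℝ → Set) → ℕ
  card P = choose (IsCardinality P) 0

  tarskiQuery : Poly → Poly → ℤ
  tarskiQuery p q =
    ℤ.+ card (λ x → eval p x ≃ 0ᵣ × 0ᵣ <ᵣ eval q x) ℤ.-
    ℤ.+ card (λ x → eval p x ≃ 0ᵣ × eval q x <ᵣ 0ᵣ)

  -- RREFs exist, so the fallback is never taken; they are also unique.
  rref : ∀ {r c} → Matrix r c → Matrix r c
  rref A = choose (λ E → RowEquivalent A E × IsRREF E) A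

  -- default n is the fixed default vector of length n.
  module _ (default : ∀ n → Vector ℚ n) where

    solveLinear : ∀ {r c} → Matrix r c → Vector ℚ r → Vector ℚ c
    solveLinear {c = c} A v with em {∃ (SquareWithInverse A)}
    ... | yes (A⁻¹ , _) = A⁻¹ *ᵥ v
    ... | no  _         = default c

    reduce : Poly → List Poly × SignData → SignData
    reduce p (qs , mkSignData {r} {c} M S Σ) =
      mkSignData (A ∘ lookup R) (S ∘ lookup R) (Σ ∘ lookup kept)
      where
      v : Vector ℚ r
      v i = tarskiQuery p (productₚ (List.map (nth qs) (S i))) / 1

      kept : List (Fin c)
      kept = nonzeros (solveLinear M v)

      A : Matrix r (length kept)
      A i j = M i (lookup kept j)

      R : List (Fin r)
      R = pivots (rref (transpose A))

    calcDataAcc : Poly → (qs : List Poly) → Acc ℕ._<_ (length qs) → SignData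
    calcDataAcc p [] _ = mkSignData M S (drop 1 ∘ Σ)
      where open SignData (reduce p ([ 1ₚ ] , base))
    calcDataAcc p (q ∷ []) _ = reduce p (q ∷ [] , base)
    calcDataAcc p qs@(_ ∷ _ ∷ qs′) (acc rs) =
      reduce p (combine (qs₁ , calcDataAcc p qs₁ (rs qs₁<qs))
                        (qs₂ , calcDataAcc p qs₂ (rs qs₂<qs)))
      where
      h : ℕ
      h = ⌊ length qs /2⌋

      qs₁ qs₂ : List Poly
      qs₁ = take h qs
      qs₂ = drop h qs

      qs₁<qs : length qs₁ ℕ.< length qs
      qs₁<qs = ℕₚ.≤-<-trans
        (ℕₚ.≤-trans (ℕₚ.≤-reflexive (Listₚ.length-take h qs)) (ℕₚ.m⊓n≤m h (length qs)))
        (ℕₚ.⌊n/2⌋<n (suc (length qs′)))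

      qs₂<qs : length qs₂ ℕ.< length qs
      qs₂<qs = subst (ℕ._< length qs) (sym (Listₚ.length-drop h qs))
        (ℕₚ.∸-monoʳ-< {length qs} {h} {0} (ℕ.s≤s ℕ.z≤n)
          (ℕₚ.<⇒≤ (ℕₚ.⌊n/2⌋<n (suc (length qs′)))))

    calcData : Poly → List Poly → SignData
    calcData p qs = calcDataAcc p qs (<-wellFounded (length qs))

    findConsistentSignsAtRoots : Poly → List Poly → List SignVector
    findConsistentSignsAtRoots p qs = Vector.toList (SignData.Σ (calcData p qs))

{-# OPTIONS --safe #-}

module Submission where

-- Let x range over the finitely many real roots of p. The invariant of the
-- recursion is that M is square and invertible, that the entries of Σ are
-- distinct and include the sign vector of every root, and that in the column of
-- the sign vector of x the entry of row i is the sign of ∏ (k ∈ S i) qs k at x.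
-- Then M w is the vector of Tarski queries when w j counts the roots with sign
-- vector Σ j, so solving the system computes w, and dropping its zeros leaves
-- exactly the realized sign vectors. The remaining columns A are linearly
-- independent. If E = P Aᵀ is the reduced row echelon form with P invertible,
-- then E has no zero row and its pivot columns form the identity matrix, so the
-- selected rows of A form the matrix (P⁻¹)ᵀ, which is invertible. Kronecker
-- products preserve the invariant because signs and matrix products are
-- multiplicative. The base case needs that p and q have no common root x, since
-- otherwise X - x would divide the unit 1.

open import Defs

import Algebra.Properties.CommutativeMonoid.Sum as CommutativeMonoidSum
import Algebra.Properties.Semiring.Sum as SemiringSum
open import Algebra.Bundles using (CommutativeRing)
open import Algebra.Definitions.RawMagma using () renaming (_,_ to _by_)
open import Axiom.ExcludedMiddle using (ExcludedMiddle)
open import Data.Fin.Base as Fin using (Fin; zero; suc; cast; remQuot; _↑ˡ_; _↑ʳ_)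
open import Data.Fin.Patterns using (0F; 1F)
import Data.Fin.Properties as Finₚ
open import Data.Integer.Base as ℤ using (ℤ)
import Data.Integer.Properties as ℤₚ
open import Data.List.Base as List
  using (List; []; _∷_; [_]; _++_; length; map; take; drop; lookup; filter; tabulate; allFin; mapMaybe)
import Data.List.Properties as Listₚ
open import Data.List.Membership.Propositional using (_∈_)
open import Data.List.Membership.Propositional.Properties
  using (∈-allFin; ∈-filter⁺; ∈-filter⁻; ∈-lookup; ∈-tabulate⁺; ∈-tabulate⁻)
open import Data.List.Relation.Unary.All as All using (All; []; _∷_)
import Data.List.Relation.Unary.All.Properties as Allₚ
import Data.List.Relation.Unary.AllPairs as AllPairs
open import Data.List.Relation.Unary.Any using (Any; here; there; index)
open import Data.List.Relation.Unary.Any.Properties using (lookup-index)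
open import Data.List.Relation.Unary.Unique.Propositional using (Unique)
open import Data.List.Relation.Unary.Unique.Propositional.Properties
  using () renaming (filter⁺ to unique-filter⁺; allFin⁺ to unique-allFin⁺)
open import Data.Maybe.Base as Maybe using (Maybe; just; nothing)
open import Data.Maybe.Properties using (just-injective)
open import Data.Nat.Base as ℕ using (ℕ; zero; suc; ⌊_/2⌋)
open import Data.Nat.Induction using (Acc; acc; <-wellFounded)
import Data.Nat.Properties as ℕₚ
open import Data.Product.Base using (_×_; _,_; proj₁; proj₂; ∃; ∃-syntax)
open import Data.Rational.Base
  using (ℚ; 0ℚ; 1ℚ; ½; _+_; _-_; _*_; -_; 1/_; _/_; ∣_∣; _<_; _≤_;
         Positive; positive; NonZero; ≢-nonZero; toℚᵘ; fromℚᵘ)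
import Data.Rational.Properties as ℚₚ
open import Data.Rational.Solver using (module +-*-Solver)
open import Data.Rational.Unnormalised.Base as ℚᵘ using (mkℚᵘ; *≡*)
import Data.Rational.Unnormalised.Properties as ℚᵘₚ
open import Data.Sum.Base using (_⊎_; inj₁; inj₂)
open import Data.Vec.Functional using (Vector; transpose) renaming (_∷_ to infixr 5 _∷ᵥ_)
open import Function.Base using (_∘_; id)
open import Function.Bundles using (_⇔_; mk⇔)
open import Level using (0ℓ)
open import Relation.Binary.PropositionalEquality
  using (_≡_; _≢_; refl; sym; trans; cong; cong₂; subst; subst₂; module ≡-Reasoning)
open import Relation.Nullary.Decidable.Core using (Dec; yes; no; ¬?; from-yes)
open import Relation.Nullary.Negation.Core using (¬_; contradiction)
open import Relation.Unary using (Decidable)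

open ℚₚ using (_≟_)
open +-*-Solver using (solve; _:+_; _:*_; _:-_; :-_; _:=_; con)
open CommutativeMonoidSum ℚₚ.+-0-commutativeMonoid using (∑-comm; ∑-distrib-+)
  renaming (sum-cong-≗ to ∑-cong)
open SemiringSum (CommutativeRing.semiring ℚₚ.+-*-commutativeRing)
  using (*-distribˡ-sum; *-distribʳ-sum)

-- Before a reduction, Σ may contain sign vectors that no root realizes, and nothing is asserted
-- about M in their columns. This does no harm: their weight in the vector of root counts is 0, and
-- invertibility makes that vector the only solution. Distinctness of Σ lets a realized sign vector
-- determine its column, so that its count is found there and is nonzero. Hence there are two
-- invariants, `Adequate` before a reduction and `Exact` after it. Cardinalities, inverses and
-- echelon forms are picked by excluded middle from a specification. Each use therefore needs the
-- existence of a suitable object and may argue only from the specification; this is why Gaussian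
-- elimination is carried out in full and why two enumerations of the same set must be compared.
-- Real arithmetic is termwise on Cauchy sequences, so ring identities reduce to identities of
-- rationals at each index. Estimates with ε are confined to `_≃_` and `_<ᵣ_`.

private variable
  a b ε : ℚ
  x y z w : ℝ
  m n k l r c : ℕ

-- Real numbers

-- The side condition is the linear identity saying that b - a is the sum of
-- the two positive differences q - p and s - r.
sum-certifies-< : ∀ {p q r s} → p < q → r < s → b + (p + r) ≡ a + (q + s) → a < b
sum-certifies-< {b} {a} {p} {q} {r} {s} p<q r<s eq =
  subst₂ _<_
    (trans (cong (_- (q + s)) eq) (cancel a (q + s))) (cancel b (q + s))
    (ℚₚ.+-monoˡ-< (- (q + s)) (ℚₚ.+-monoʳ-< b (ℚₚ.+-mono-< p<q r<s)))
  where
  cancel : ∀ a b → (a + b) - b ≡ a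
  cancel = solve 2 (λ a b → (a :+ b) :- b := a) refl

+-pos : 0ℚ < a → 0ℚ < b → 0ℚ < a + b
+-pos = ℚₚ.+-mono-<

*-pos : 0ℚ < a → 0ℚ < b → 0ℚ < a * b
*-pos {a} {b} 0<a 0<b = ℚₚ.positive⁻¹ (a * b)
  {{ℚₚ.pos*pos⇒pos a {{positive 0<a}} b {{positive 0<b}}}}

halve : 0ℚ < ε → ∃[ δ ] 0ℚ < δ × δ + δ ≡ ε
halve {ε} 0<ε = ½ * ε , *-pos (ℚₚ.positive⁻¹ ½) 0<ε ,
  trans (sym (ℚₚ.*-distribʳ-+ ε ½ ½)) (ℚₚ.*-identityˡ ε)

divide-pos : 0ℚ < b → 0ℚ < ε → ∃[ δ ] 0ℚ < δ × b * δ ≡ ε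
divide-pos {b} {ε} 0<b 0<ε =
  1/ b * ε , *-pos (ℚₚ.positive⁻¹ (1/ b) {{ℚₚ.1/pos⇒pos b}}) 0<ε ,
  trans (sym (ℚₚ.*-assoc b (1/ b) ε))
    (trans (cong (_* ε) (ℚₚ.*-inverseʳ b)) (ℚₚ.*-identityˡ ε))
  where instance
    b⁺ : Positive b
    b⁺ = positive 0<b
    b≠0 : NonZero b
    b≠0 = ℚₚ.pos⇒nonZero b

a≤∣a∣ : ∀ a → a ≤ ∣ a ∣
a≤∣a∣ a with ℚₚ.≤-total 0ℚ a
... | inj₁ 0≤a = ℚₚ.≤-reflexive (sym (ℚₚ.0≤p⇒∣p∣≡p 0≤a))
... | inj₂ a≤0 = ℚₚ.≤-trans a≤0 (ℚₚ.0≤∣p∣ a)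

∣a∣<b⇒a<b : ∣ a ∣ < b → a < b
∣a∣<b⇒a<b {a} = ℚₚ.≤-<-trans (a≤∣a∣ a)

∣a∣<b⇒-a<b : ∣ a ∣ < b → - a < b
∣a∣<b⇒-a<b {a} {b} h = ∣a∣<b⇒a<b (subst (_< b) (sym (ℚₚ.∣-p∣≡∣p∣ a)) h)

bounds⇒∣a∣<b : a < b → - a < b → ∣ a ∣ < b
bounds⇒∣a∣<b {a} {b} a<b -a<b with ℚₚ.∣p∣≡p∨∣p∣≡-p a
... | inj₁ eq = subst (_< b) (sym eq) a<b
... | inj₂ eq = subst (_< b) (sym eq) -a<b

Eventually : (ℕ → Set) → Set
Eventually P = ∃[ N ] ∀ n → N ℕ.≤ n → P n

eventually-map : ∀ {P Q : ℕ → Set} → Eventually P → (∀ n → P n → Q n) → Eventually Q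
eventually-map (N , h) f = N , λ n N≤n → f n (h n N≤n)

eventually-map₂ : ∀ {P Q R : ℕ → Set} → Eventually P → Eventually Q →
                  (∀ n → P n → Q n → R n) → Eventually R
eventually-map₂ (M , g) (N , h) f = M ℕ.⊔ N , λ n M⊔N≤n →
    f n (g n (ℕₚ.≤-trans (ℕₚ.m≤m⊔n M N) M⊔N≤n))
        (h n (ℕₚ.≤-trans (ℕₚ.m≤n⊔m M N) M⊔N≤n))

eventually-const : ∀ {P : Set} → Eventually (λ _ → P) → P
eventually-const (N , h) = h N ℕₚ.≤-refl

infix 4 _≐_

-- Termwise equality of the representing sequences. Evaluation and coefficients are computed
-- termwise, so polynomial identities hold in this strong form and follow from rational ring
-- identities.
_≐_ : ℝ → ℝ → Set
x ≐ y = ∀ n → seq x n ≡ seq y n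

≐⇒≃ : x ≐ y → x ≃ y
≐⇒≃ {x} {y} x≐y ε 0<ε = 0 , λ n _ → subst (_< ε)
  (sym (cong ∣_∣ (trans (cong (_- seq y n) (x≐y n)) (ℚₚ.+-inverseʳ (seq y n))))) 0<ε

≃-refl : x ≃ x
≃-refl {x} = ≐⇒≃ {x} {x} λ _ → refl

≃-sym : x ≃ y → y ≃ x
≃-sym {x} {y} x≃y ε 0<ε = eventually-map (x≃y ε 0<ε) λ n → subst (_< ε)
  (trans (sym (ℚₚ.∣-p∣≡∣p∣ (seq x n - seq y n)))
    (cong ∣_∣ (neg-sub (seq x n) (seq y n))))
  where
  neg-sub : ∀ a b → - (a - b) ≡ b - a
  neg-sub = solve 2 (λ a b → :- (a :- b) := b :- a) refl

∣+∣< : ∀ {c d} → ∣ a ∣ < c → ∣ b ∣ < d → ∣ a + b ∣ < c + d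
∣+∣< {a} {b} h k = ℚₚ.≤-<-trans (ℚₚ.∣p+q∣≤∣p∣+∣q∣ a b) (ℚₚ.+-mono-< h k)

≃-trans : x ≃ y → y ≃ z → x ≃ z
≃-trans {x} {y} {z} x≃y y≃z ε 0<ε with halve 0<ε
... | δ , 0<δ , refl = eventually-map₂ (x≃y δ 0<δ) (y≃z δ 0<δ)
  λ n h k → subst (_< δ + δ)
    (cong ∣_∣ (telescope (seq x n) (seq y n) (seq z n))) (∣+∣< h k)
  where
  telescope : ∀ a b c → (a - b) + (b - c) ≡ a - c
  telescope = solve 3 (λ a b c → (a :- b) :+ (b :- c) := a :- c) refl

+ᵣ-cong : x ≃ y → z ≃ w → x +ᵣ z ≃ y +ᵣ w
+ᵣ-cong {x} {y} {z} {w} x≃y z≃w ε 0<ε with halve 0<ε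
... | δ , 0<δ , refl = eventually-map₂ (x≃y δ 0<δ) (z≃w δ 0<δ)
  λ n h k → subst (_< δ + δ)
    (cong ∣_∣ (regroup (seq x n) (seq y n) (seq z n) (seq w n))) (∣+∣< h k)
  where
  regroup : ∀ a b c d → (a - b) + (c - d) ≡ (a + c) - (b + d)
  regroup = solve 4 (λ a b c d → (a :- b) :+ (c :- d) := (a :+ c) :- (b :+ d)) refl

eventually-bounded : ∀ x → ∃[ b ] 0ℚ < b × Eventually (λ n → ∣ seq x n ∣ ≤ b)
eventually-bounded x with cauchy x 1ℚ (ℚₚ.positive⁻¹ 1ℚ)
... | N , h = 1ℚ + ∣ seq x N ∣ ,
  ℚₚ.+-mono-<-≤ {0ℚ} {1ℚ} {0ℚ} (ℚₚ.positive⁻¹ 1ℚ) (ℚₚ.0≤∣p∣ (seq x N)) ,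
  N , λ n N≤n → begin
    ∣ seq x n ∣                         ≡⟨ cong ∣_∣ (split (seq x n) (seq x N)) ⟩
    ∣ (seq x n - seq x N) + seq x N ∣   ≤⟨ ℚₚ.∣p+q∣≤∣p∣+∣q∣ (seq x n - seq x N) (seq x N) ⟩
    ∣ seq x n - seq x N ∣ + ∣ seq x N ∣ ≤⟨ ℚₚ.+-monoˡ-≤ ∣ seq x N ∣ (ℚₚ.<⇒≤ (h n N N≤n ℕₚ.≤-refl)) ⟩
    1ℚ + ∣ seq x N ∣                    ∎
  where
  open ℚₚ.≤-Reasoning
  split : ∀ a b → a ≡ (a - b) + b
  split = solve 2 (λ a b → a := (a :- b) :+ b) refl

scaled-difference : ∀ a c d → 0ℚ < b → ∣ a ∣ ≤ b → ∣ c - d ∣ < ε →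
                    ∣ a * c - a * d ∣ < b * ε
scaled-difference {b} {ε} a c d 0<b a≤b h = begin-strict
  ∣ a * c - a * d ∣     ≡⟨ cong ∣_∣ (factor a c d) ⟩
  ∣ a * (c - d) ∣       ≡⟨ ℚₚ.∣p*q∣≡∣p∣*∣q∣ a (c - d) ⟩
  ∣ a ∣ * ∣ c - d ∣     ≤⟨ ℚₚ.*-monoʳ-≤-nonNeg ∣ c - d ∣ {{ℚₚ.∣-∣-nonNeg (c - d)}} a≤b ⟩
  b * ∣ c - d ∣         <⟨ ℚₚ.*-monoʳ-<-pos b {{positive 0<b}} h ⟩
  b * ε                 ∎
  where
  open ℚₚ.≤-Reasoning
  factor : ∀ a b c → a * b - a * c ≡ a * (b - c)
  factor = solve 3 (λ a b c → a :* b :- a :* c := a :* (b :- c)) refl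

-- The terms of x are eventually bounded by some b, so it is enough that y and z come within ε / b
-- of each other.
*ᵣ-congˡ : y ≃ z → x *ᵣ y ≃ x *ᵣ z
*ᵣ-congˡ {y} {z} {x} y≃z ε 0<ε =
  let b , 0<b , x≤b  = eventually-bounded x
      δ , 0<δ , bδ≡ε = divide-pos 0<b 0<ε
  in eventually-map₂ x≤b (y≃z δ 0<δ) λ n h k →
       subst (∣ seq x n * seq y n - seq x n * seq z n ∣ <_) bδ≡ε
         (scaled-difference {b} {δ} (seq x n) (seq y n) (seq z n) 0<b h k)

*ᵣ-comm : ∀ x y → x *ᵣ y ≃ y *ᵣ x
*ᵣ-comm x y = ≐⇒≃ {x *ᵣ y} {y *ᵣ x} λ n → ℚₚ.*-comm (seq x n) (seq y n)

*ᵣ-cong : x ≃ y → z ≃ w → x *ᵣ z ≃ y *ᵣ w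
*ᵣ-cong {x} {y} {z} {w} x≃y z≃w =
  ≃-trans {x *ᵣ z} {x *ᵣ w} {y *ᵣ w} (*ᵣ-congˡ {z} {w} {x} z≃w)
    (≃-trans {x *ᵣ w} {w *ᵣ x} {y *ᵣ w} (*ᵣ-comm x w)
      (≃-trans {w *ᵣ x} {w *ᵣ y} {y *ᵣ w} (*ᵣ-congˡ {x} {y} {w} x≃y) (*ᵣ-comm w y)))

-- Half of the gap between x and y is given up to absorb the distance from y to z; the other half
-- remains as the new gap.
<ᵣ-respʳ-≃ : x <ᵣ y → y ≃ z → x <ᵣ z
<ᵣ-respʳ-≃ {x} {y} {z} (ε , 0<ε , x<y) y≃z with halve 0<ε
... | δ , 0<δ , refl = δ , 0<δ , eventually-map₂ x<y (y≃z δ 0<δ)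
  λ n h k → sum-certifies-< h (∣a∣<b⇒a<b k) (rearrange (seq x n) (seq y n) (seq z n) δ)
  where
  rearrange : ∀ a b c d → c + ((a + (d + d)) + (b - c)) ≡ (a + d) + (b + d)
  rearrange = solve 4 (λ a b c d →
    c :+ ((a :+ (d :+ d)) :+ (b :- c)) := (a :+ d) :+ (b :+ d)) refl

<ᵣ-respˡ-≃ : x <ᵣ y → x ≃ z → z <ᵣ y
<ᵣ-respˡ-≃ {x} {y} {z} (ε , 0<ε , x<y) x≃z with halve 0<ε
... | δ , 0<δ , refl = δ , 0<δ , eventually-map₂ x<y (x≃z δ 0<δ)
  λ n h k → sum-certifies-< h (∣a∣<b⇒-a<b k) (rearrange (seq x n) (seq y n) (seq z n) δ)
  where
  rearrange : ∀ a b c d → b + ((a + (d + d)) + (- (a - c))) ≡ (c + d) + (b + d)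
  rearrange = solve 4 (λ a b c d →
    b :+ ((a :+ (d :+ d)) :+ (:- (a :- c))) := (c :+ d) :+ (b :+ d)) refl

<ᵣ-irrefl : x ≃ y → ¬ x <ᵣ y
<ᵣ-irrefl {x} {y} x≃y x<y with <ᵣ-respˡ-≃ {x} {y} {y} x<y x≃y
... | ε , 0<ε , y<y = eventually-const (eventually-map y<y λ n h →
  ℚₚ.<-irrefl refl (sum-certifies-< {0ℚ} {0ℚ} 0<ε h (rearrange (seq y n) ε)))
  where
  rearrange : ∀ a e → 0ℚ + (0ℚ + (a + e)) ≡ 0ℚ + (e + a)
  rearrange = solve 2 (λ a e → con 0ℚ :+ (con 0ℚ :+ (a :+ e)) := con 0ℚ :+ (e :+ a)) refl

<ᵣ-trans : x <ᵣ y → y <ᵣ z → x <ᵣ z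
<ᵣ-trans {x} {y} {z} (ε , 0<ε , x<y) (δ , 0<δ , y<z) = ε + δ , +-pos 0<ε 0<δ ,
  eventually-map₂ x<y y<z λ n h k →
    sum-certifies-< h k (rearrange (seq x n) (seq y n) (seq z n) ε δ)
  where
  rearrange : ∀ a b c e d → c + ((a + e) + (b + d)) ≡ (a + (e + d)) + (b + c)
  rearrange = solve 5 (λ a b c e d →
    c :+ ((a :+ e) :+ (b :+ d)) := (a :+ (e :+ d)) :+ (b :+ c)) refl

<ᵣ-asym : x <ᵣ y → ¬ y <ᵣ x
<ᵣ-asym {x} {y} x<y y<x = <ᵣ-irrefl {x} {x} (≃-refl {x}) (<ᵣ-trans {x} {y} {x} x<y y<x)

0<1ᵣ : 0ᵣ <ᵣ 1ᵣ
-- The gap must satisfy 0 + ε < 1 strictly, so 1 itself is too large.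
0<1ᵣ = ½ , ℚₚ.positive⁻¹ ½ , 0 , λ _ _ → from-yes ((0ℚ + ½) ℚₚ.<? 1ℚ)

-- A real that is not null has a tail of one sign, bounded away from 0.
trichotomy : ExcludedMiddle 0ℓ → ∀ x → x <ᵣ 0ᵣ ⊎ x ≃ 0ᵣ ⊎ 0ᵣ <ᵣ x
trichotomy em x with em {0ᵣ <ᵣ x} | em {x <ᵣ 0ᵣ}
... | yes x>0 | _       = inj₂ (inj₂ x>0)
... | no  _   | yes x<0 = inj₁ x<0
... | no  x≯0 | no  x≮0 = inj₂ (inj₁ null)
  where
  null : x ≃ 0ᵣ
  -- Halving twice gives ε = 4γ, and beyond N any two terms differ by less than γ. A term there of
  -- absolute value at least 4γ would keep all terms beyond N on its side of 0 at distance more than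
  -- γ, against `x≯0` or `x≮0`.
  null ε 0<ε with halve 0<ε
  ... | δ , 0<δ , refl with halve 0<δ | cauchy x
  ... | γ , 0<γ , refl | cx with cx γ 0<γ
  ... | N , h = N , λ n N≤n → bounds⇒∣a∣<b {seq x n - 0ℚ}
    (above n N≤n) (below n N≤n)
    where
    above : ∀ n → N ℕ.≤ n → seq x n - 0ℚ < (γ + γ) + (γ + γ)
    above n N≤n with (seq x n - 0ℚ) ℚₚ.<? ((γ + γ) + (γ + γ))
    ... | yes x<ε = x<ε
    ... | no  x≮ε = contradiction (γ , 0<γ , N , λ m N≤m → sum-certifies-<
      (ℚₚ.<-≤-trans (sum-certifies-< {(γ + γ) + (γ + γ)} {γ + γ} 0<γ 0<γ (rearrange₁ γ)) (ℚₚ.≮⇒≥ x≮ε))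
      (∣a∣<b⇒a<b (h n m N≤n N≤m)) (rearrange₂ (seq x n) (seq x m) γ)) x≯0
      where
      rearrange₁ : ∀ c → ((c + c) + (c + c)) + (0ℚ + 0ℚ) ≡ (c + c) + (c + c)
      rearrange₁ = solve 1 (λ c → ((c :+ c) :+ (c :+ c)) :+ (con 0ℚ :+ con 0ℚ) := (c :+ c) :+ (c :+ c)) refl
      rearrange₂ : ∀ a b c → b + ((c + c) + (a - b)) ≡ (0ℚ + c) + ((a - 0ℚ) + c)
      rearrange₂ = solve 3 (λ a b c → b :+ ((c :+ c) :+ (a :- b)) :=
        (con 0ℚ :+ c) :+ ((a :- con 0ℚ) :+ c)) refl
    below : ∀ n → N ℕ.≤ n → - (seq x n - 0ℚ) < (γ + γ) + (γ + γ)
    below n N≤n with (- (seq x n - 0ℚ)) ℚₚ.<? ((γ + γ) + (γ + γ))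
    ... | yes x<ε = x<ε
    ... | no  x≮ε = contradiction (γ , 0<γ , N , λ m N≤m → sum-certifies-<
      (ℚₚ.<-≤-trans (sum-certifies-< {(γ + γ) + (γ + γ)} {γ + γ} 0<γ 0<γ (rearrange₁ γ)) (ℚₚ.≮⇒≥ x≮ε))
      (∣a∣<b⇒a<b (h m n N≤m N≤n)) (rearrange₂ (seq x n) (seq x m) γ)) x≮0
      where
      rearrange₁ : ∀ c → ((c + c) + (c + c)) + (0ℚ + 0ℚ) ≡ (c + c) + (c + c)
      rearrange₁ = solve 1 (λ c → ((c :+ c) :+ (c :+ c)) :+ (con 0ℚ :+ con 0ℚ) := (c :+ c) :+ (c :+ c)) refl
      rearrange₂ : ∀ a b c → 0ℚ + ((c + c) + (b - a)) ≡ (b + c) + ((- (a - 0ℚ)) + c)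
      rearrange₂ = solve 3 (λ a b c → con 0ℚ :+ ((c :+ c) :+ (b :- a)) :=
        (b :+ c) :+ ((:- (a :- con 0ℚ)) :+ c)) refl

-- As a product with the constant -1, negation inherits the Cauchy property from `_*ᵣ_`.
-ᵣ_ : ℝ → ℝ
-ᵣ x = fromℚ (- 1ℚ) *ᵣ x

infix 8 -ᵣ_

x<0⇒0<-x : x <ᵣ 0ᵣ → 0ᵣ <ᵣ -ᵣ x
x<0⇒0<-x {x} (ε , 0<ε , x<0) with halve 0<ε
... | δ , 0<δ , refl = δ , 0<δ ,
  eventually-map x<0 λ n h → sum-certifies-< h 0<δ (rearrange₁ (seq x n) δ)
  where
  rearrange₁ : ∀ a d → - 1ℚ * a + ((a + (d + d)) + 0ℚ) ≡ (0ℚ + d) + (0ℚ + d)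
  rearrange₁ = solve 2 (λ a d → con (- 1ℚ) :* a :+ ((a :+ (d :+ d)) :+ con 0ℚ) :=
    (con 0ℚ :+ d) :+ (con 0ℚ :+ d)) refl

0<-x⇒x<0 : 0ᵣ <ᵣ -ᵣ x → x <ᵣ 0ᵣ
0<-x⇒x<0 {x} (ε , 0<ε , 0<-x) with halve 0<ε
... | δ , 0<δ , refl = δ , 0<δ ,
  eventually-map 0<-x λ n h → sum-certifies-< h 0<δ (rearrange₁ (seq x n) δ)
  where
  rearrange₁ : ∀ a d → 0ℚ + ((0ℚ + (d + d)) + 0ℚ) ≡ (a + d) + (- 1ℚ * a + d)
  rearrange₁ = solve 2 (λ a d → con 0ℚ :+ ((con 0ℚ :+ (d :+ d)) :+ con 0ℚ) :=
    (a :+ d) :+ (con (- 1ℚ) :* a :+ d)) refl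

-- Signs of products of reals

*ᵣ-pos-pos : 0ᵣ <ᵣ x → 0ᵣ <ᵣ y → 0ᵣ <ᵣ x *ᵣ y
*ᵣ-pos-pos {x} {y} (ε , 0<ε , 0<x) (δ , 0<δ , 0<y) = ε * δ , *-pos 0<ε 0<δ ,
  eventually-map₂ 0<x 0<y λ n h k →
    subst (_< seq x n * seq y n) (sym (ℚₚ.+-identityˡ (ε * δ))) (*-mono 0<ε 0<δ
      (subst (_< seq x n) (ℚₚ.+-identityˡ ε) h) (subst (_< seq y n) (ℚₚ.+-identityˡ δ) k))
  where
  *-mono : ∀ {a b c d} → 0ℚ < a → 0ℚ < b → a < c → b < d → a * b < c * d
  *-mono {a} 0<a 0<b a<c b<d = ℚₚ.<-trans
    (ℚₚ.*-monoʳ-<-pos a {{positive 0<a}} b<d)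
    (ℚₚ.*-monoˡ-<-pos _ {{positive (ℚₚ.<-trans 0<b b<d)}} a<c)

*ᵣ-neg-pos : x <ᵣ 0ᵣ → 0ᵣ <ᵣ y → x *ᵣ y <ᵣ 0ᵣ
*ᵣ-neg-pos {x} {y} x<0 0<y = 0<-x⇒x<0 {x *ᵣ y}
  (<ᵣ-respʳ-≃ {0ᵣ} { -ᵣ x *ᵣ y} { -ᵣ (x *ᵣ y)}
    (*ᵣ-pos-pos { -ᵣ x} {y} (x<0⇒0<-x {x} x<0) 0<y)
    (≐⇒≃ { -ᵣ x *ᵣ y} { -ᵣ (x *ᵣ y)} λ n → ℚₚ.*-assoc (- 1ℚ) (seq x n) (seq y n)))

*ᵣ-pos-neg : 0ᵣ <ᵣ x → y <ᵣ 0ᵣ → x *ᵣ y <ᵣ 0ᵣ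
*ᵣ-pos-neg {x} {y} 0<x y<0 =
  <ᵣ-respˡ-≃ {y *ᵣ x} {0ᵣ} {x *ᵣ y} (*ᵣ-neg-pos {y} {x} y<0 0<x) (*ᵣ-comm y x)

*ᵣ-neg-neg : x <ᵣ 0ᵣ → y <ᵣ 0ᵣ → 0ᵣ <ᵣ x *ᵣ y
*ᵣ-neg-neg {x} {y} x<0 y<0 =
  <ᵣ-respʳ-≃ {0ᵣ} { -ᵣ x *ᵣ -ᵣ y} {x *ᵣ y}
    (*ᵣ-pos-pos { -ᵣ x} { -ᵣ y} (x<0⇒0<-x {x} x<0) (x<0⇒0<-x {y} y<0))
    (≐⇒≃ { -ᵣ x *ᵣ -ᵣ y} {x *ᵣ y} λ n → rearrange₁ (seq x n) (seq y n))
  where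
  rearrange₁ : ∀ a b → (- 1ℚ * a) * (- 1ℚ * b) ≡ a * b
  rearrange₁ = solve 2 (λ a b → (con (- 1ℚ) :* a) :* (con (- 1ℚ) :* b) := a :* b) refl

*ᵣ-zeroˡ : x ≃ 0ᵣ → x *ᵣ y ≃ 0ᵣ
*ᵣ-zeroˡ {x} {y} x≃0 = ≃-trans {x *ᵣ y} {0ᵣ *ᵣ y} {0ᵣ}
  (*ᵣ-cong {x} {0ᵣ} {y} {y} x≃0 (≃-refl {y}))
  (≐⇒≃ {0ᵣ *ᵣ y} {0ᵣ} λ n → ℚₚ.*-zeroˡ (seq y n))

*ᵣ-zeroʳ : y ≃ 0ᵣ → x *ᵣ y ≃ 0ᵣ
*ᵣ-zeroʳ {y} {x} y≃0 = ≃-trans {x *ᵣ y} {y *ᵣ x} {0ᵣ} (*ᵣ-comm x y) (*ᵣ-zeroˡ {y} {x} y≃0)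

module _ (em : ExcludedMiddle 0ℓ) where

  -- By trichotomy two nonzero factors have strict signs, and then so does their product. This is
  -- what allows a root to be divided out of a polynomial.
  *ᵣ-integral : ∀ x y → x *ᵣ y ≃ 0ᵣ → x ≃ 0ᵣ ⊎ y ≃ 0ᵣ
  *ᵣ-integral x y xy≃0 with trichotomy em x | trichotomy em y
  ... | inj₂ (inj₁ x≃0) | _               = inj₁ x≃0
  ... | _               | inj₂ (inj₁ y≃0) = inj₂ y≃0
  ... | inj₁ x<0 | inj₁ y<0 =
    contradiction (*ᵣ-neg-neg {x} {y} x<0 y<0) (<ᵣ-irrefl {0ᵣ} {x *ᵣ y} (≃-sym {x *ᵣ y} {0ᵣ} xy≃0))
  ... | inj₁ x<0 | inj₂ (inj₂ 0<y) =
    contradiction (*ᵣ-neg-pos {x} {y} x<0 0<y) (<ᵣ-irrefl {x *ᵣ y} {0ᵣ} xy≃0)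
  ... | inj₂ (inj₂ 0<x) | inj₁ y<0 =
    contradiction (*ᵣ-pos-neg {x} {y} 0<x y<0) (<ᵣ-irrefl {x *ᵣ y} {0ᵣ} xy≃0)
  ... | inj₂ (inj₂ 0<x) | inj₂ (inj₂ 0<y) =
    contradiction (*ᵣ-pos-pos {x} {y} 0<x 0<y) (<ᵣ-irrefl {0ᵣ} {x *ᵣ y} (≃-sym {x *ᵣ y} {0ᵣ} xy≃0))

  sgn-pos : 0ᵣ <ᵣ x → sgn em x ≡ pos
  sgn-pos {x} 0<x with em {0ᵣ <ᵣ x} | em {x <ᵣ 0ᵣ}
  ... | yes _  | _ = refl
  ... | no 0≮x | _ = contradiction 0<x 0≮x

  sgn-neg : x <ᵣ 0ᵣ → sgn em x ≡ neg
  sgn-neg {x} x<0 with em {0ᵣ <ᵣ x} | em {x <ᵣ 0ᵣ}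
  ... | yes 0<x | _      = contradiction 0<x (<ᵣ-asym {x} {0ᵣ} x<0)
  ... | no _    | yes _  = refl
  ... | no _    | no x≮0 = contradiction x<0 x≮0

  sgn-zer : x ≃ 0ᵣ → sgn em x ≡ zer
  sgn-zer {x} x≃0 with em {0ᵣ <ᵣ x} | em {x <ᵣ 0ᵣ}
  ... | yes 0<x | _       = contradiction 0<x (<ᵣ-irrefl {0ᵣ} {x} (≃-sym {x} {0ᵣ} x≃0))
  ... | no _    | yes x<0 = contradiction x<0 (<ᵣ-irrefl {x} {0ᵣ} x≃0)
  ... | no _    | no _    = refl

  sgn-cong : x ≃ y → sgn em x ≡ sgn em y
  sgn-cong {x} {y} x≃y with trichotomy em x
  ... | inj₁ x<0 = trans (sgn-neg {x} x<0) (sym (sgn-neg {y} (<ᵣ-respˡ-≃ {x} {0ᵣ} {y} x<0 x≃y)))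
  ... | inj₂ (inj₁ x≃0) = trans (sgn-zer {x} x≃0)
    (sym (sgn-zer {y} (≃-trans {y} {x} {0ᵣ} (≃-sym {x} {y} x≃y) x≃0)))
  ... | inj₂ (inj₂ 0<x) = trans (sgn-pos {x} 0<x)
    (sym (sgn-pos {y} (<ᵣ-respʳ-≃ {0ᵣ} {x} {y} 0<x x≃y)))

signℚ : Sgn → ℚ
signℚ neg = - 1ℚ
signℚ zer = 0ℚ
signℚ pos = 1ℚ

signℚ-* : (em : ExcludedMiddle 0ℓ) → ∀ x y →
          signℚ (sgn em (x *ᵣ y)) ≡ signℚ (sgn em x) * signℚ (sgn em y)
signℚ-* em x y = cases (trichotomy em x) (trichotomy em y)
  where
  Trichotomy : ℝ → Set
  Trichotomy x = x <ᵣ 0ᵣ ⊎ x ≃ 0ᵣ ⊎ 0ᵣ <ᵣ x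

  combine-signs : ∀ {s t u} → sgn em x ≡ s → sgn em y ≡ t → sgn em (x *ᵣ y) ≡ u →
                  signℚ u ≡ signℚ s * signℚ t →
                  signℚ (sgn em (x *ᵣ y)) ≡ signℚ (sgn em x) * signℚ (sgn em y)
  combine-signs p q r eq = trans (cong signℚ r)
    (trans eq (sym (cong₂ (λ s t → signℚ s * signℚ t) p q)))

  cases : Trichotomy x → Trichotomy y →
          signℚ (sgn em (x *ᵣ y)) ≡ signℚ (sgn em x) * signℚ (sgn em y)
  cases (inj₂ (inj₁ x≃0)) _ =
    combine-signs (sgn-zer em {x} x≃0) refl (sgn-zer em {x *ᵣ y} (*ᵣ-zeroˡ {x} {y} x≃0))
      (sym (ℚₚ.*-zeroˡ (signℚ (sgn em y))))
  cases _ (inj₂ (inj₁ y≃0)) =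
    combine-signs refl (sgn-zer em {y} y≃0) (sgn-zer em {x *ᵣ y} (*ᵣ-zeroʳ {y} {x} y≃0))
      (sym (ℚₚ.*-zeroʳ (signℚ (sgn em x))))
  cases (inj₁ x<0) (inj₁ y<0) = combine-signs (sgn-neg em {x} x<0) (sgn-neg em {y} y<0)
    (sgn-pos em {x *ᵣ y} (*ᵣ-neg-neg {x} {y} x<0 y<0)) refl
  cases (inj₁ x<0) (inj₂ (inj₂ 0<y)) = combine-signs (sgn-neg em {x} x<0) (sgn-pos em {y} 0<y)
    (sgn-neg em {x *ᵣ y} (*ᵣ-neg-pos {x} {y} x<0 0<y)) refl
  cases (inj₂ (inj₂ 0<x)) (inj₁ y<0) = combine-signs (sgn-pos em {x} 0<x) (sgn-neg em {y} y<0)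
    (sgn-neg em {x *ᵣ y} (*ᵣ-pos-neg {x} {y} 0<x y<0)) refl
  cases (inj₂ (inj₂ 0<x)) (inj₂ (inj₂ 0<y)) =
    combine-signs (sgn-pos em {x} 0<x) (sgn-pos em {y} 0<y)
      (sgn-pos em {x *ᵣ y} (*ᵣ-pos-pos {x} {y} 0<x 0<y)) refl

-- Real polynomials and their roots

eval-cong : ∀ p {x y} → x ≃ y → eval p x ≃ eval p y
eval-cong []      {x} {y} x≃y = ≃-refl {0ᵣ}
eval-cong (a ∷ p) {x} {y} x≃y =
  +ᵣ-cong {a} {a} {x *ᵣ eval p x} {y *ᵣ eval p y} (≃-refl {a})
    (*ᵣ-cong {x} {y} {eval p x} {eval p y} x≃y (eval-cong p x≃y))

eval-+ₚ : ∀ p q x → eval (p +ₚ q) x ≐ eval p x +ᵣ eval q x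
eval-+ₚ []      q       x n = sym (ℚₚ.+-identityˡ (seq (eval q x) n))
eval-+ₚ (a ∷ p) []      x n = sym (ℚₚ.+-identityʳ (seq (eval (a ∷ p) x) n))
eval-+ₚ (a ∷ p) (b ∷ q) x n =
  trans (cong (λ e → (seq a n + seq b n) + seq x n * e) (eval-+ₚ p q x n))
    (regroup (seq a n) (seq b n) (seq x n) (seq (eval p x) n) (seq (eval q x) n))
  where
  regroup : ∀ a b x u v → (a + b) + x * (u + v) ≡ (a + x * u) + (b + x * v)
  regroup = solve 5 (λ a b x u v →
    (a :+ b) :+ x :* (u :+ v) := (a :+ x :* u) :+ (b :+ x :* v)) refl

eval-scale : ∀ a q x → eval (map (a *ᵣ_) q) x ≐ a *ᵣ eval q x
eval-scale a []      x n = sym (ℚₚ.*-zeroʳ (seq a n))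
eval-scale a (b ∷ q) x n =
  trans (cong (λ e → seq a n * seq b n + seq x n * e) (eval-scale a q x n))
    (regroup (seq a n) (seq b n) (seq x n) (seq (eval q x) n))
  where
  regroup : ∀ a b x u → a * b + x * (a * u) ≡ a * (b + x * u)
  regroup = solve 4 (λ a b x u → a :* b :+ x :* (a :* u) := a :* (b :+ x :* u)) refl

eval-*ₚ : ∀ p q x → eval (p *ₚ q) x ≐ eval p x *ᵣ eval q x
eval-*ₚ []      q x n = sym (ℚₚ.*-zeroˡ (seq (eval q x) n))
eval-*ₚ (a ∷ p) q x n =
  trans (eval-+ₚ (map (a *ᵣ_) q) (0ᵣ ∷ p *ₚ q) x n)
    (trans (cong₂ (λ u v → u + (0ℚ + seq x n * v)) (eval-scale a q x n) (eval-*ₚ p q x n))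
      (regroup (seq a n) (seq x n) (seq (eval p x) n) (seq (eval q x) n)))
  where
  regroup : ∀ a x u v → a * v + (0ℚ + x * (u * v)) ≡ (a + x * u) * v
  regroup = solve 4 (λ a x u v →
    a :* v :+ (con 0ℚ :+ x :* (u :* v)) := (a :+ x :* u) :* v) refl

coeff-+ₚ : ∀ p q k → coeff (p +ₚ q) k ≐ coeff p k +ᵣ coeff q k
coeff-+ₚ []      q       k       n = sym (ℚₚ.+-identityˡ (seq (coeff q k) n))
coeff-+ₚ (a ∷ p) []      k       n = sym (ℚₚ.+-identityʳ (seq (coeff (a ∷ p) k) n))
coeff-+ₚ (a ∷ p) (b ∷ q) zero    n = refl
coeff-+ₚ (a ∷ p) (b ∷ q) (suc k) n = coeff-+ₚ p q k n

eval-zero : ∀ p → p ≈ₚ 0ₚ → ∀ x → eval p x ≃ 0ᵣ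
eval-zero []      p≈0 x = ≃-refl {0ᵣ}
eval-zero (a ∷ p) p≈0 x =
  ≃-trans {a +ᵣ x *ᵣ eval p x} {0ᵣ +ᵣ 0ᵣ} {0ᵣ}
    (+ᵣ-cong {a} {0ᵣ} {x *ᵣ eval p x} {0ᵣ} (p≈0 0)
      (*ᵣ-zeroʳ {eval p x} {x} (eval-zero p (p≈0 ∘ suc) x)))
    (≐⇒≃ {0ᵣ +ᵣ 0ᵣ} {0ᵣ} λ _ → refl)

eval-≈ₚ : ∀ p q → p ≈ₚ q → ∀ x → eval p x ≃ eval q x
eval-≈ₚ []      q       p≈q x = ≃-sym {eval q x} {0ᵣ}
  (eval-zero q (λ k → ≃-sym {0ᵣ} {coeff q k} (p≈q k)) x)
eval-≈ₚ (a ∷ p) []      p≈q x = eval-zero (a ∷ p) p≈q x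
eval-≈ₚ (a ∷ p) (b ∷ q) p≈q x =
  +ᵣ-cong {a} {b} {x *ᵣ eval p x} {x *ᵣ eval q x} (p≈q 0)
    (*ᵣ-cong {x} {x} {eval p x} {eval q x} (≃-refl {x}) (eval-≈ₚ p q (p≈q ∘ suc) x))

-- Synthetic division: for every a, quotient r p is the quotient of a ∷ p by X - r.
quotient : ℝ → Poly → Poly
quotient r []      = []
quotient r (b ∷ p) = eval (b ∷ p) r ∷ quotient r p

linear : ℝ → Poly
linear r = -ᵣ r ∷ 1ᵣ ∷ []

length-quotient : ∀ r p → length (quotient r p) ≡ length p
length-quotient r []      = refl
length-quotient r (b ∷ p) = cong suc (length-quotient r p)

-- Division by X - r with the value at r as remainder. The induction closes because the leading
-- entry of the quotient list is itself the remainder of the tail.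
eval-quotient : ∀ a p r x →
  eval (a ∷ p) x ≐ eval (a ∷ p) r +ᵣ (x +ᵣ -ᵣ r) *ᵣ eval (quotient r p) x
eval-quotient a []      r x n = rearrange (seq a n) (seq r n) (seq x n)
  where
  rearrange : ∀ a r x → a + x * 0ℚ ≡ (a + r * 0ℚ) + (x + - 1ℚ * r) * 0ℚ
  rearrange = solve 3 (λ a r x → a :+ x :* con 0ℚ :=
    (a :+ r :* con 0ℚ) :+ (x :+ con (- 1ℚ) :* r) :* con 0ℚ) refl
eval-quotient a (b ∷ p) r x n =
  trans (cong (λ e → seq a n + seq x n * e) (eval-quotient b p r x n))
    (rearrange (seq a n) (seq r n) (seq x n) (seq (eval (b ∷ p) r) n)
      (seq (eval (quotient r p) x) n))
  where
  rearrange : ∀ a r x e q → a + x * (e + (x + - 1ℚ * r) * q) ≡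
              (a + r * e) + (x + - 1ℚ * r) * (e + x * q)
  rearrange = solve 5 (λ a r x e q →
    a :+ x :* (e :+ (x :+ con (- 1ℚ) :* r) :* q) :=
    (a :+ r :* e) :+ (x :+ con (- 1ℚ) :* r) :* (e :+ x :* q)) refl

-- The right side is a ∷ p minus its value at r, for any a: the constant coefficient becomes a - (a
-- + r p(r)) = - r p(r). Divisibility compares coefficients, so the identity of values in
-- `eval-quotient` does not suffice.
quotient-*-linear : ∀ r p k →
  coeff (quotient r p *ₚ linear r) k ≐ coeff (-ᵣ (r *ᵣ eval p r) ∷ p) k
quotient-*-linear r [] zero    n = rearrange (seq r n)
  where
  rearrange : ∀ r → 0ℚ ≡ - 1ℚ * (r * 0ℚ)
  rearrange = solve 1 (λ r → con 0ℚ := con (- 1ℚ) :* (r :* con 0ℚ)) refl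
quotient-*-linear r [] (suc k) n = refl
quotient-*-linear r (b ∷ p) zero n = rearrange (seq r n) (seq (eval (b ∷ p) r) n)
  where
  rearrange : ∀ r e → e * (- 1ℚ * r) + 0ℚ ≡ - 1ℚ * (r * e)
  rearrange = solve 2 (λ r e → e :* (con (- 1ℚ) :* r) :+ con 0ℚ := con (- 1ℚ) :* (r :* e)) refl
quotient-*-linear r (b ∷ p) (suc k) n =
  trans (coeff-+ₚ (eval (b ∷ p) r *ᵣ 1ᵣ ∷ []) (quotient r p *ₚ linear r) k n)
    (trans (cong (seq (coeff (eval (b ∷ p) r *ᵣ 1ᵣ ∷ []) k) n +_) (quotient-*-linear r p k n))
      (go k))
  where
  rearrange : ∀ b r e → (b + r * e) * 1ℚ + - 1ℚ * (r * e) ≡ b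
  rearrange = solve 3 (λ b r e →
    (b :+ r :* e) :* con 1ℚ :+ con (- 1ℚ) :* (r :* e) := b) refl

  go : ∀ k → seq (coeff (eval (b ∷ p) r *ᵣ 1ᵣ ∷ []) k) n +
             seq (coeff (-ᵣ (r *ᵣ eval p r) ∷ p) k) n ≡ seq (coeff (b ∷ p) k) n
  go zero    = rearrange (seq b n) (seq r n) (seq (eval p r) n)
  go (suc k) = ℚₚ.+-identityˡ (seq (coeff p k) n)

-- At a root a + r p(r) vanishes, p being the tail, so the constant coefficient - r p(r) of the
-- product equals a.
linear-∣ₚ : ∀ p r → eval p r ≃ 0ᵣ → linear r ∣ₚ p
linear-∣ₚ []      r _   = [] by λ k → ≃-refl {0ᵣ}
linear-∣ₚ (a ∷ p) r p≃0 = quotient r p by coefficients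
  where
  re : ℝ
  re = r *ᵣ eval p r

  rearrange : ∀ a u → a ≡ (a + u) + - 1ℚ * u
  rearrange = solve 2 (λ a u → a := (a :+ u) :+ con (- 1ℚ) :* u) refl

  -re≃a : -ᵣ re ≃ a
  -re≃a = ≃-sym {a} { -ᵣ re} (≃-trans {a} {(a +ᵣ re) +ᵣ -ᵣ re} { -ᵣ re}
    (≐⇒≃ {a} {(a +ᵣ re) +ᵣ -ᵣ re} λ n → rearrange (seq a n) (seq re n))
    (≃-trans {(a +ᵣ re) +ᵣ -ᵣ re} {0ᵣ +ᵣ -ᵣ re} { -ᵣ re}
      (+ᵣ-cong {a +ᵣ re} {0ᵣ} { -ᵣ re} { -ᵣ re} p≃0 (≃-refl { -ᵣ re}))
      (≐⇒≃ {0ᵣ +ᵣ -ᵣ re} { -ᵣ re} λ n → ℚₚ.+-identityˡ (seq (-ᵣ re) n))))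

  coefficients : quotient r p *ₚ linear r ≈ₚ a ∷ p
  coefficients zero = ≃-trans {coeff (quotient r p *ₚ linear r) 0} { -ᵣ re} {a}
    (≐⇒≃ {coeff (quotient r p *ₚ linear r) 0} { -ᵣ re} (quotient-*-linear r p 0)) -re≃a
  coefficients (suc k) =
    ≐⇒≃ {coeff (quotient r p *ₚ linear r) (suc k)} {coeff p k} (quotient-*-linear r p (suc k))

eval-linear-root : ∀ r → eval (linear r) r ≐ 0ᵣ
eval-linear-root r n = rearrange (seq r n)
  where
  rearrange : ∀ r → - 1ℚ * r + r * (1ℚ + r * 0ℚ) ≡ 0ℚ
  rearrange = solve 1 (λ r → con (- 1ℚ) :* r :+ r :* (con 1ℚ :+ r :* con 0ℚ) := con 0ℚ) refl

eval-1ₚ : ∀ x → eval 1ₚ x ≐ 1ᵣ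
eval-1ₚ x n = trans (cong (1ℚ +_) (ℚₚ.*-zeroʳ (seq x n))) (ℚₚ.+-identityʳ 1ℚ)

coprime⇒no-common-root : ∀ p q → Coprime p q → ∀ x → eval p x ≃ 0ᵣ → ¬ eval q x ≃ 0ᵣ
coprime⇒no-common-root p q coprime x p≃0 q≃0
  with coprime (linear x) (linear-∣ₚ p x p≃0) (linear-∣ₚ q x q≃0)
... | d by d*l≈1 = <ᵣ-irrefl {0ᵣ} {1ᵣ} 0≃1 0<1ᵣ
  where
  0≃1 : 0ᵣ ≃ 1ᵣ
  0≃1 = ≃-sym {1ᵣ} {0ᵣ} (≃-trans {1ᵣ} {eval 1ₚ x} {0ᵣ}
    (≃-sym {eval 1ₚ x} {1ᵣ} (≐⇒≃ {eval 1ₚ x} {1ᵣ} (eval-1ₚ x)))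
    (≃-trans {eval 1ₚ x} {eval (d *ₚ linear x) x} {0ᵣ}
      (≃-sym {eval (d *ₚ linear x) x} {eval 1ₚ x} (eval-≈ₚ (d *ₚ linear x) 1ₚ d*l≈1 x))
      (≃-trans {eval (d *ₚ linear x) x} {eval d x *ᵣ eval (linear x) x} {0ᵣ}
        (≐⇒≃ {eval (d *ₚ linear x) x} {eval d x *ᵣ eval (linear x) x} (eval-*ₚ d (linear x) x))
        (*ᵣ-zeroʳ {eval (linear x) x} {eval d x}
          (≐⇒≃ {eval (linear x) x} {0ᵣ} (eval-linear-root x))))))

+ᵣ-zeroʳ⁻ : ∀ a {u} → u ≃ 0ᵣ → a +ᵣ u ≃ 0ᵣ → a ≃ 0ᵣ
+ᵣ-zeroʳ⁻ a {u} u≃0 a+u≃0 = ≃-trans {a} {a +ᵣ 0ᵣ} {0ᵣ}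
  (≐⇒≃ {a} {a +ᵣ 0ᵣ} λ n → sym (ℚₚ.+-identityʳ (seq a n)))
  (≃-trans {a +ᵣ 0ᵣ} {a +ᵣ u} {0ᵣ}
    (+ᵣ-cong {a} {a} {0ᵣ} {u} (≃-refl {a}) (≃-sym {u} {0ᵣ} u≃0)) a+u≃0)

constant-coeff-zero : ∀ a p r → p ≈ₚ 0ₚ → eval (a ∷ p) r ≃ 0ᵣ → a ∷ p ≈ₚ 0ₚ
constant-coeff-zero a p r p≈0 root zero    = +ᵣ-zeroʳ⁻ a {r *ᵣ eval p r}
  (*ᵣ-zeroʳ {eval p r} {r} (eval-zero p p≈0 r)) root
constant-coeff-zero a p r p≈0 root (suc k) = p≈0 k

-- The coefficients of the quotient are the values at r of the successive tails of p. Starting from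
-- the last one, each vanishing value forces one more coefficient of p to vanish. This keeps the
-- quotient nonzero when a root is divided out.
quotient≈0⇒≈0 : ∀ r p → quotient r p ≈ₚ 0ₚ → p ≈ₚ 0ₚ
quotient≈0⇒≈0 r []      _   = λ k → ≃-refl {0ᵣ}
quotient≈0⇒≈0 r (b ∷ p) q≈0 =
  constant-coeff-zero b p r (quotient≈0⇒≈0 r p (q≈0 ∘ suc)) (q≈0 0)

sub≃0⇒≃ : ∀ x r → x +ᵣ -ᵣ r ≃ 0ᵣ → x ≃ r
sub≃0⇒≃ x r h ε 0<ε = eventually-map (h ε 0<ε) λ n →
  subst (_< ε) (cong ∣_∣ (rearrange (seq x n) (seq r n)))
  where
  rearrange : ∀ x r → (x + - 1ℚ * r) - 0ℚ ≡ x - r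
  rearrange = solve 2 (λ x r → (x :+ con (- 1ℚ) :* r) :- con 0ℚ := x :- r) refl

-- Finiteness of the set of real roots

Root : Poly → ℝ → Set
Root p x = eval p x ≃ 0ᵣ

module _ (em : ExcludedMiddle 0ℓ) where

  -- Induction on the degree bound n. If there is a root r, every root is r or a root of the
  -- quotient, which has one coefficient fewer. A multiple root may be listed several times;
  -- `enumerate` removes the repetitions.
  roots-covered′ : ∀ n a p → length p ≡ n → ¬ (a ∷ p ≈ₚ 0ₚ) →
                   ∃[ L ] ∀ x → eval (a ∷ p) x ≃ 0ᵣ → Any (x ≃_) L
  roots-covered′ zero a [] _ p≉0 =
    [] , λ x root → contradiction (constant-coeff-zero a [] x (λ _ → ≃-refl {0ᵣ}) root) p≉0
  roots-covered′ (suc n) a p@(b ∷ p′) eq p≉0 with em {∃[ r ] eval (a ∷ p) r ≃ 0ᵣ}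
  ... | no  no-root     = [] , λ x root → contradiction (x , root) no-root
  ... | yes (r , rroot) =
    let L , covers = roots-covered′ n (eval p r) (quotient r p′)
          (trans (length-quotient r p′) (ℕₚ.suc-injective eq))
          (λ q≈0 → p≉0 (constant-coeff-zero a p r (quotient≈0⇒≈0 r p q≈0) rroot))
    in r ∷ L , λ x root → split covers x (*ᵣ-integral em (x +ᵣ -ᵣ r) (eval (quotient r p) x)
         (product≃0 x root))
    where
    split : ∀ {L} → (∀ x → eval (quotient r p) x ≃ 0ᵣ → Any (x ≃_) L) →
            ∀ x → (x +ᵣ -ᵣ r ≃ 0ᵣ) ⊎ (eval (quotient r p) x ≃ 0ᵣ) → Any (x ≃_) (r ∷ L)
    split covers x (inj₁ x-r≃0) = here (sub≃0⇒≃ x r x-r≃0)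
    split covers x (inj₂ q≃0)   = there (covers x q≃0)

    product≃0 : ∀ x → eval (a ∷ p) x ≃ 0ᵣ → (x +ᵣ -ᵣ r) *ᵣ eval (quotient r p) x ≃ 0ᵣ
    product≃0 x root = +ᵣ-zeroʳ⁻ mult {eval (a ∷ p) r} rroot
      (≃-trans {mult +ᵣ eval (a ∷ p) r} {eval (a ∷ p) x} {0ᵣ}
        (≐⇒≃ {mult +ᵣ eval (a ∷ p) r} {eval (a ∷ p) x} λ n →
          trans (ℚₚ.+-comm (seq mult n) (seq (eval (a ∷ p) r) n)) (sym (eval-quotient a p r x n)))
        root)
      where
      mult : ℝ
      mult = (x +ᵣ -ᵣ r) *ᵣ eval (quotient r p) x

  roots-covered : ∀ p → ¬ (p ≈ₚ 0ₚ) → ∃[ L ] ∀ x → eval p x ≃ 0ᵣ → Any (x ≃_) L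
  roots-covered []      p≉0 = contradiction (λ k → ≃-refl {0ᵣ}) p≉0
  roots-covered (a ∷ p) p≉0 = roots-covered′ (length p) a p refl p≉0

  module _ {P : ℝ → Set} (P-resp : ∀ {x y} → x ≃ y → P x → P y) where

    -- An entry of L joins the enumeration only if it satisfies P and is not equivalent to one
    -- already present; excluded middle decides both.
    enumerate : ∀ L → ∃[ n ] ∃ λ (f : Fin n → ℝ) → (∀ i → P (f i)) ×
                (∀ i j → f i ≃ f j → i ≡ j) ×
                (∀ x → P x → Any (x ≃_) L → ∃[ i ] x ≃ f i)
    enumerate []      = 0 , (λ ()) , (λ ()) , (λ ()) , λ x Px ()
    enumerate (a ∷ L) with enumerate L
    ... | n , f , f-P , f-inj , f-covers with em {∃[ i ] a ≃ f i} | em {P a}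
    ... | yes (i , a≃fi) | _ = n , f , f-P , f-inj , λ where
      x Px (here x≃a)  → i , ≃-trans {x} {a} {f i} x≃a a≃fi
      x Px (there x∈L) → f-covers x Px x∈L
    ... | no _ | no ¬Pa = n , f , f-P , f-inj , λ where
      x Px (here x≃a)  → contradiction (P-resp {x} {a} x≃a Px) ¬Pa
      x Px (there x∈L) → f-covers x Px x∈L
    ... | no a∉f | yes Pa = suc n , g , g-P , g-inj , g-covers
      where
      g : Fin (suc n) → ℝ
      g zero    = a
      g (suc i) = f i

      g-P : ∀ i → P (g i)
      g-P zero    = Pa
      g-P (suc i) = f-P i

      g-inj : ∀ i j → g i ≃ g j → i ≡ j
      g-inj zero    zero    _ = refl
      g-inj zero    (suc j) e = contradiction (j , e) a∉f
      g-inj (suc i) zero    e = contradiction (i , ≃-sym {f i} {a} e) a∉f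
      g-inj (suc i) (suc j) e = cong suc (f-inj i j e)

      g-covers : ∀ x → P x → Any (x ≃_) (a ∷ L) → ∃[ i ] x ≃ g i
      g-covers x Px (here x≃a)  = zero , x≃a
      g-covers x Px (there x∈L) =
        let i , x≃fi = f-covers x Px x∈L in suc i , x≃fi

  finitely-many-roots : ∀ p → ¬ (p ≈ₚ 0ₚ) → ∃[ n ] IsCardinality (Root p) n
  finitely-many-roots p p≉0 =
    let L , covers              = roots-covered p p≉0
        n , f , f-P , f-inj , f-covers = enumerate {λ x → eval p x ≃ 0ᵣ}
          (λ {x} {y} x≃y px → ≃-trans {eval p y} {eval p x} {0ᵣ}
            (≃-sym {eval p x} {eval p y} (eval-cong p {x} {y} x≃y)) px) L
    in n , f , f-P , f-inj , λ x Px → f-covers x Px (covers x Px)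

-- Counting roots by Tarski queries

fromℚᵘ-+ : ∀ p q → fromℚᵘ (p ℚᵘ.+ q) ≡ fromℚᵘ p + fromℚᵘ q
fromℚᵘ-+ p q = ℚₚ.toℚᵘ-injective (begin
  toℚᵘ (fromℚᵘ (p ℚᵘ.+ q))              ≈⟨ ℚₚ.toℚᵘ-fromℚᵘ (p ℚᵘ.+ q) ⟩
  p ℚᵘ.+ q                              ≈⟨ ℚᵘₚ.+-cong (ℚₚ.toℚᵘ-fromℚᵘ p) (ℚₚ.toℚᵘ-fromℚᵘ q) ⟨
  toℚᵘ (fromℚᵘ p) ℚᵘ.+ toℚᵘ (fromℚᵘ q)  ≈⟨ ℚₚ.toℚᵘ-homo-+ (fromℚᵘ p) (fromℚᵘ q) ⟨
  toℚᵘ (fromℚᵘ p + fromℚᵘ q)            ∎)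
  where open import Relation.Binary.Reasoning.Setoid ℚᵘₚ.≃-setoid

/1-+ : ∀ i j → (i ℤ.+ j) / 1 ≡ i / 1 + j / 1
/1-+ i j = trans
  (ℚₚ.fromℚᵘ-cong {mkℚᵘ (i ℤ.+ j) 0} {mkℚᵘ i 0 ℚᵘ.+ mkℚᵘ j 0}
    (*≡* (cong (ℤ._* ℤ.+ 1) (sym (cong₂ ℤ._+_ (ℤₚ.*-identityʳ i) (ℤₚ.*-identityʳ j))))))
  (fromℚᵘ-+ (mkℚᵘ i 0) (mkℚᵘ j 0))

/1-- : ∀ i j → (i ℤ.- j) / 1 ≡ i / 1 - j / 1
/1-- i j = trans (add-sub ((i ℤ.- j) / 1) (j / 1))
  (cong (_- j / 1) (trans (sym (/1-+ (i ℤ.- j) j))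
    (cong (_/ 1) (trans (ℤₚ.+-assoc i (ℤ.- j) j)
      (trans (cong (λ k → i ℤ.+ k) (ℤₚ.+-inverseˡ j)) (ℤₚ.+-identityʳ i))))))
  where
  add-sub : ∀ a b → a ≡ (a + b) - b
  add-sub = solve 2 (λ a b → a := (a :+ b) :- b) refl

indicator : ∀ {A : Set} → Dec A → ℚ
indicator (yes _) = 1ℚ
indicator (no  _) = 0ℚ

length-filter : ∀ {A : Set} {P : A → Set} (P? : Decidable P) {n} (f : Fin n → A) →
                (ℤ.+ length (filter P? (tabulate f))) / 1 ≡ ∑ (indicator ∘ P? ∘ f)
length-filter P? {zero}  f = refl
length-filter P? {suc n} f with P? (f zero)
... | yes _ = trans (/1-+ (ℤ.+ 1) (ℤ.+ length (filter P? (tabulate (f ∘ suc)))))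
  (cong (1ℚ +_) (length-filter P? (f ∘ suc)))
... | no  _ = trans (length-filter P? (f ∘ suc)) (sym (ℚₚ.+-identityˡ (∑ (indicator ∘ P? ∘ f ∘ suc))))

lookup-injective : ∀ {A : Set} {xs : List A} → Unique xs →
                   ∀ {i j} → lookup xs i ≡ lookup xs j → i ≡ j
lookup-injective {xs = xs} (x∉ AllPairs.∷ u) {zero} {zero} _ = refl
lookup-injective {xs = _ ∷ xs} (x∉ AllPairs.∷ u) {zero} {suc j} e =
  contradiction e (All.lookup x∉ (∈-lookup {xs = xs} j))
lookup-injective {xs = _ ∷ xs} (x∉ AllPairs.∷ u) {suc i} {zero} e =
  contradiction (sym e) (All.lookup x∉ (∈-lookup {xs = xs} i))
lookup-injective (x∉ AllPairs.∷ u) {suc i} {suc j} e = cong suc (lookup-injective u e)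

-- Sending i to a position of f i in g is injective, since a common position makes f i and f j
-- equivalent.
IsCardinality-≤ : ∀ {P m n} → IsCardinality P m → IsCardinality P n → m ℕ.≤ n
IsCardinality-≤ {P} {m} {n} (f , f-P , f-inj , _) (g , _ , _ , g-covers) =
  Finₚ.injective⇒≤ {f = λ i → proj₁ (position i)} λ {i} {j} eq →
    f-inj i j (≃-trans {f i} {g (proj₁ (position i))} {f j} (proj₂ (position i))
      (subst (λ k → g k ≃ f j) (sym eq)
        (≃-sym {f j} {g (proj₁ (position j))} (proj₂ (position j)))))
  where
  position : ∀ i → ∃[ k ] f i ≃ g k
  position i = g-covers (f i) (f-P i)

module _ (em : ExcludedMiddle 0ℓ) where

  choose-satisfies : ∀ {A : Set} {P : A → Set} {a} fallback → P a → P (choose em P fallback)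
  choose-satisfies {P = P} {a} fallback Pa with em {∃ P}
  ... | yes (_ , Pb) = Pb
  ... | no  ∄P       = contradiction (a , Pa) ∄P

  -- `card` returns some admissible number chosen by excluded middle, so a count obtained from a
  -- concrete enumeration has to be shown equal to it.
  card-unique : ∀ {P n} → IsCardinality P n → card em P ≡ n
  card-unique {P} {n} c = ℕₚ.≤-antisym (IsCardinality-≤ chosen c) (IsCardinality-≤ c chosen)
    where
    chosen : IsCardinality P (card em P)
    chosen = choose-satisfies {P = IsCardinality P} 0 c

  -- Filtering one fixed enumeration of P turns the positive and the negative count of a Tarski
  -- query into sums over the same index set, which can then be subtracted term by term.
  card-restrict : ∀ {P Q : ℝ → Set} {n} (c : IsCardinality P n) →
                  (∀ {x y} → x ≃ y → Q x → Q y) →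
                  (ℤ.+ card em (λ x → P x × Q x)) / 1 ≡ ∑ λ i → indicator (em {Q (proj₁ c i)})
  card-restrict {P} {Q} {n} (f , f-P , f-inj , f-covers) Q-resp =
    trans (cong (λ k → ℤ.+ k / 1) (card-unique subset)) (length-filter Q? id)
    where
    Q? : Decidable (Q ∘ f)
    Q? i = em

    sub : List (Fin n)
    sub = filter Q? (allFin n)

    subset : IsCardinality (λ x → P x × Q x) (length sub)
    subset = f ∘ lookup sub ,
      (λ i → f-P (lookup sub i) , proj₂ (∈-filter⁻ Q? {xs = allFin n} (∈-lookup {xs = sub} i))) ,
      (λ i j e → lookup-injective (unique-filter⁺ Q? (unique-allFin⁺ n))
        (f-inj (lookup sub i) (lookup sub j) e)) ,
      λ x (Px , Qx) →
        let i , x≃fi = f-covers x Px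
            i∈sub    = ∈-filter⁺ Q? (∈-allFin i) (Q-resp {x} {f i} x≃fi Qx)
        in index i∈sub , subst (λ k → x ≃ f k) (lookup-index i∈sub) x≃fi

  signℚ-indicators : ∀ y → signℚ (sgn em y) ≡
    indicator (em {0ᵣ <ᵣ y}) - indicator (em {y <ᵣ 0ᵣ})
  signℚ-indicators y with em {0ᵣ <ᵣ y} | em {y <ᵣ 0ᵣ}
  ... | yes 0<y | yes y<0 = contradiction y<0 (<ᵣ-asym {0ᵣ} {y} 0<y)
  ... | yes _   | no  _   = refl
  ... | no  _   | yes _   = refl
  ... | no  _   | no  _   = refl

  tarskiQuery-sum : ∀ p q {n} (c : IsCardinality (λ x → eval p x ≃ 0ᵣ) n) →
    tarskiQuery em p q / 1 ≡ ∑ λ a → signℚ (sgn em (eval q (proj₁ c a)))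
  tarskiQuery-sum p q {n} c = trans (/1-- (ℤ.+ card em Pos) (ℤ.+ card em Neg))
    (trans (cong₂ _-_
      (card-restrict c λ {x} {y} x≃y 0<qx →
        <ᵣ-respʳ-≃ {0ᵣ} {eval q x} {eval q y} 0<qx (eval-cong q {x} {y} x≃y))
      (card-restrict c λ {x} {y} x≃y qx<0 →
        <ᵣ-respˡ-≃ {eval q x} {0ᵣ} {eval q y} qx<0 (eval-cong q {x} {y} x≃y)))
    (trans (sym (∑-- (λ a → indicator (em {0ᵣ <ᵣ eval q (f a)}))
                     (λ a → indicator (em {eval q (f a) <ᵣ 0ᵣ}))))
      (∑-cong λ a → sym (signℚ-indicators (eval q (f a))))))
    where
    f : Fin n → ℝ
    f = proj₁ c

    Pos Neg : ℝ → Set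
    Pos x = eval p x ≃ 0ᵣ × 0ᵣ <ᵣ eval q x
    Neg x = eval p x ≃ 0ᵣ × eval q x <ᵣ 0ᵣ

    ∑-- : ∀ {n} (f g : Fin n → ℚ) → ∑ (λ i → f i - g i) ≡ ∑ f - ∑ g
    ∑-- {zero}  f g = refl
    ∑-- {suc n} f g = trans (cong (f zero - g zero +_) (∑-- (f ∘ suc) (g ∘ suc)))
      (regroup (f zero) (g zero) (∑ (f ∘ suc)) (∑ (g ∘ suc)))
      where
      regroup : ∀ a b c d → (a - b) + (c - d) ≡ (a + c) - (b + d)
      regroup = solve 4 (λ a b c d → (a :- b) :+ (c :- d) := (a :+ c) :- (b :+ d)) refl

-- Rational matrices

∑-zero : {f : Vector ℚ n} → (∀ i → f i ≡ 0ℚ) → ∑ f ≡ 0ℚ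
∑-zero {zero}  f≗0 = refl
∑-zero {suc n} f≗0 = cong₂ _+_ (f≗0 zero) (∑-zero (f≗0 ∘ suc))

∑-single : {f : Vector ℚ n} (i : Fin n) → (∀ k → k ≢ i → f k ≡ 0ℚ) → ∑ f ≡ f i
∑-single {f = f} zero    off = trans (cong (f zero +_) (∑-zero λ k → off (suc k) λ ()))
  (ℚₚ.+-identityʳ (f zero))
∑-single {f = f} (suc i) off = trans
  (cong₂ _+_ (off zero λ ()) (∑-single i λ k k≢i → off (suc k) (k≢i ∘ Finₚ.suc-injective)))
  (ℚₚ.+-identityˡ (f (suc i)))

identity-diagonal : {i j : Fin n} → i ≡ j → identity n i j ≡ 1ℚ
identity-diagonal {i = i} {j} i≡j with i Finₚ.≟ j
... | yes _   = refl
... | no  i≢j = contradiction i≡j i≢j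

identity-off-diagonal : {i j : Fin n} → i ≢ j → identity n i j ≡ 0ℚ
identity-off-diagonal {i = i} {j} i≢j with i Finₚ.≟ j
... | yes i≡j = contradiction i≡j i≢j
... | no  _   = refl

identity-injection : (f : Fin m → Fin n) → (∀ {i j} → f i ≡ f j → i ≡ j) →
                     ∀ i j → identity n (f i) (f j) ≡ identity m i j
identity-injection f f-inj i j with i Finₚ.≟ j
... | yes i≡j = identity-diagonal (cong f i≡j)
... | no  i≢j = identity-off-diagonal (i≢j ∘ f-inj)

identity-sym : ∀ (i j : Fin n) → identity n i j ≡ identity n j i
identity-sym i j with i Finₚ.≟ j
... | yes i≡j = sym (identity-diagonal (sym i≡j))
... | no  i≢j = sym (identity-off-diagonal (i≢j ∘ sym))

∑-identityʳ : ∀ (f : Vector ℚ n) j → ∑ (λ k → f k * identity n k j) ≡ f j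
∑-identityʳ f j = trans
  (∑-single j λ k k≢j → trans (cong (f k *_) (identity-off-diagonal k≢j)) (ℚₚ.*-zeroʳ (f k)))
  (trans (cong (f j *_) (identity-diagonal {i = j} refl)) (ℚₚ.*-identityʳ (f j)))

∑-identityˡ : ∀ (f : Vector ℚ n) i → ∑ (λ k → identity n i k * f k) ≡ f i
∑-identityˡ {n} f i = trans
  (∑-cong λ k → trans (cong (_* f k) (identity-sym i k)) (ℚₚ.*-comm (identity n k i) (f k)))
  (∑-identityʳ f i)

-- Associativity of row times matrix times column, in a form that serves products with vectors and
-- with matrices alike.
∑-assoc : ∀ (a : Vector ℚ m) (b : Matrix m n) (v : Vector ℚ n) →
          ∑ (λ k → ∑ (λ l → a l * b l k) * v k) ≡ ∑ (λ l → a l * ∑ (λ k → b l k * v k))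
∑-assoc a b v = begin
  ∑ (λ k → ∑ (λ l → a l * b l k) * v k)   ≡⟨ ∑-cong (λ k → *-distribʳ-sum (v k) (λ l → a l * b l k)) ⟩
  ∑ (λ k → ∑ (λ l → a l * b l k * v k))   ≡⟨ ∑-comm (λ k l → a l * b l k * v k) ⟩
  ∑ (λ l → ∑ (λ k → a l * b l k * v k))
    ≡⟨ ∑-cong (λ l → trans (∑-cong (λ k → ℚₚ.*-assoc (a l) (b l k) (v k)))
                           (sym (*-distribˡ-sum (a l) (λ k → b l k * v k)))) ⟩
  ∑ (λ l → a l * ∑ (λ k → b l k * v k))   ∎
  where open ≡-Reasoning

*ᵥ-left-inverse : (A : Matrix m n) (B : Matrix n m) → B *ₘ A ≈ₘ identity n →
                  ∀ v i → (B *ᵥ (A *ᵥ v)) i ≡ v i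
*ᵥ-left-inverse A B BA≈1 v i = trans (sym (∑-assoc (B i) A v))
  (trans (∑-cong λ k → cong (_* v k) (BA≈1 i k)) (∑-identityˡ v i))

-- Kronecker products

∑-split : ∀ m (f : Vector ℚ (m ℕ.+ n)) → ∑ f ≡ ∑ (λ i → f (i ↑ˡ n)) + ∑ (λ j → f (m ↑ʳ j))
∑-split {n} zero    f = sym (ℚₚ.+-identityˡ (∑ f))
∑-split {n} (suc m) f = trans (cong (f zero +_) (∑-split m (f ∘ suc)))
  (sym (ℚₚ.+-assoc (f zero) (∑ (λ i → f (suc i ↑ˡ n))) (∑ (λ j → f (suc m ↑ʳ j)))))

∑-combine : ∀ m (f : Vector ℚ (m ℕ.* n)) → ∑ f ≡ ∑ λ i → ∑ λ j → f (Fin.combine {m} {n} i j)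
∑-combine     zero    f = refl
∑-combine {n} (suc m) f = trans (∑-split n f)
  (cong (∑ (λ j → f (j ↑ˡ (m ℕ.* n))) +_) (∑-combine m (f ∘ (n ↑ʳ_))))

-- The sum over the product index becomes a double sum over pairs, whose terms separate, so it
-- factors into two sums.
⊗-mixed-product : ∀ {r₁ s₁ c₁ r₂ s₂ c₂} (A : Matrix r₁ s₁) (B : Matrix r₂ s₂)
                  (C : Matrix s₁ c₁) (D : Matrix s₂ c₂) →
                  (A ⊗ B) *ₘ (C ⊗ D) ≈ₘ (A *ₘ C) ⊗ (B *ₘ D)
⊗-mixed-product {r₁} {s₁} {c₁} {r₂} {s₂} {c₂} A B C D i j = begin
  ∑ (λ k → term (remQuot {s₁} s₂ k))
    ≡⟨ ∑-combine {s₂} s₁ (λ k → term (remQuot {s₁} s₂ k)) ⟩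
  ∑ (λ a → ∑ λ b → term (remQuot {s₁} s₂ (Fin.combine {s₁} {s₂} a b)))
    ≡⟨ ∑-cong (λ a → ∑-cong λ b → cong term (Finₚ.remQuot-combine {s₁} a b)) ⟩
  ∑ (λ a → ∑ λ b → term (a , b))
    ≡⟨ ∑-cong (λ a → ∑-cong λ b → interchange (A i₁ a) (B i₂ b) (C a j₁) (D b j₂)) ⟩
  ∑ (λ a → ∑ λ b → A i₁ a * C a j₁ * (B i₂ b * D b j₂))
    ≡⟨ ∑-cong (λ a → sym (*-distribˡ-sum (A i₁ a * C a j₁) (λ b → B i₂ b * D b j₂))) ⟩
  ∑ (λ a → A i₁ a * C a j₁ * ∑ (λ b → B i₂ b * D b j₂))
    ≡⟨ sym (*-distribʳ-sum (∑ (λ b → B i₂ b * D b j₂)) (λ a → A i₁ a * C a j₁)) ⟩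
  ∑ (λ a → A i₁ a * C a j₁) * ∑ (λ b → B i₂ b * D b j₂) ∎
  where
  open ≡-Reasoning
  i₁ = proj₁ (remQuot {r₁} r₂ i)
  i₂ = proj₂ (remQuot {r₁} r₂ i)
  j₁ = proj₁ (remQuot {c₁} c₂ j)
  j₂ = proj₂ (remQuot {c₁} c₂ j)

  term : Fin s₁ × Fin s₂ → ℚ
  term (a , b) = A i₁ a * B i₂ b * (C a j₁ * D b j₂)

  interchange : ∀ a b c d → a * b * (c * d) ≡ a * c * (b * d)
  interchange = solve 4 (λ a b c d → a :* b :* (c :* d) := a :* c :* (b :* d)) refl

⊗-cong : ∀ {r₁ c₁ r₂ c₂} {A A′ : Matrix r₁ c₁} {B B′ : Matrix r₂ c₂} →
         A ≈ₘ A′ → B ≈ₘ B′ → A ⊗ B ≈ₘ A′ ⊗ B′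
⊗-cong {r₁} {c₁} {r₂} {c₂} A≈A′ B≈B′ i j = cong₂ _*_
  (A≈A′ (proj₁ (remQuot {r₁} r₂ i)) (proj₁ (remQuot {c₁} c₂ j)))
  (B≈B′ (proj₂ (remQuot {r₁} r₂ i)) (proj₂ (remQuot {c₁} c₂ j)))

⊗-identity : ∀ m n → identity m ⊗ identity n ≈ₘ identity (m ℕ.* n)
⊗-identity m n i j with i Finₚ.≟ j
... | yes refl = cong₂ _*_ (identity-diagonal {i = proj₁ (remQuot {m} n i)} refl)
                           (identity-diagonal {i = proj₂ (remQuot {m} n i)} refl)
... | no i≢j with proj₁ (remQuot {m} n i) Finₚ.≟ proj₁ (remQuot {m} n j)
... | no  _ = ℚₚ.*-zeroˡ (identity n (proj₂ (remQuot {m} n i)) (proj₂ (remQuot {m} n j)))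
... | yes i₁≡j₁ = trans (ℚₚ.*-identityˡ (identity n (proj₂ (remQuot {m} n i)) (proj₂ (remQuot {m} n j))))
  (identity-off-diagonal λ i₂≡j₂ → i≢j
    (trans (sym (Finₚ.combine-remQuot {m} n i))
      (trans (cong₂ Fin.combine i₁≡j₁ i₂≡j₂) (Finₚ.combine-remQuot {m} n j))))

⊗-inverse : ∀ {r₁ c₁ r₂ c₂} (A : Matrix r₁ c₁) (A⁻¹ : Matrix c₁ r₁)
            (B : Matrix r₂ c₂) (B⁻¹ : Matrix c₂ r₂) →
            IsInverse A A⁻¹ → IsInverse B B⁻¹ → IsInverse (A ⊗ B) (A⁻¹ ⊗ B⁻¹)
⊗-inverse {r₁} {c₁} {r₂} {c₂} A A⁻¹ B B⁻¹ (AA⁻¹ , A⁻¹A) (BB⁻¹ , B⁻¹B) =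
  (λ i j → trans (⊗-mixed-product A B A⁻¹ B⁻¹ i j)
    (trans (⊗-cong {A = A *ₘ A⁻¹} {B = B *ₘ B⁻¹} AA⁻¹ BB⁻¹ i j) (⊗-identity r₁ r₂ i j))) ,
  (λ i j → trans (⊗-mixed-product A⁻¹ B⁻¹ A B i j)
    (trans (⊗-cong {A = A⁻¹ *ₘ A} {B = B⁻¹ *ₘ B} A⁻¹A B⁻¹B i j) (⊗-identity c₁ c₂ i j)))

⊗-squareWithInverse : ∀ {r₁ c₁ r₂ c₂} (A : Matrix r₁ c₁) (B : Matrix r₂ c₂) →
  ∃ (SquareWithInverse A) → ∃ (SquareWithInverse B) → ∃ (SquareWithInverse (A ⊗ B))
⊗-squareWithInverse A B (A⁻¹ , r₁≡c₁ , A-inv) (B⁻¹ , r₂≡c₂ , B-inv) =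
  A⁻¹ ⊗ B⁻¹ , cong₂ ℕ._*_ r₁≡c₁ r₂≡c₂ , ⊗-inverse A A⁻¹ B B⁻¹ A-inv B-inv

-- Gaussian elimination

-- Row operations are treated as linear maps acting on each column. Composition and inversion are
-- then checked on vectors, and `matrix` converts to a matrix only at the end, its columns being the
-- images of the unit vectors.
record IsLinear (f : Vector ℚ m → Vector ℚ n) : Set where
  field
    f-cong : ∀ {u v} → (∀ i → u i ≡ v i) → ∀ i → f u i ≡ f v i
    f-+    : ∀ u v i → f (λ k → u k + v k) i ≡ f u i + f v i
    f-*    : ∀ a v i → f (λ k → a * v k) i ≡ a * f v i

  f-zero : ∀ {u} → (∀ i → u i ≡ 0ℚ) → ∀ i → f u i ≡ 0ℚ
  f-zero {u} u≗0 i = trans (f-cong (λ k → trans (u≗0 k) (sym (ℚₚ.*-zeroˡ (u k)))) i)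
    (trans (f-* 0ℚ u i) (ℚₚ.*-zeroˡ (f u i)))

  f-∑ : ∀ {k} (B : Matrix m k) (v : Vector ℚ k) i → f (λ j → ∑ λ l → B j l * v l) i ≡ ∑ λ l → f (λ j → B j l) i * v l
  f-∑ {zero}  B v i = f-zero (λ _ → refl) i
  f-∑ {suc k} B v i = trans (f-+ (λ j → B j zero * v zero) (λ j → ∑ λ l → B j (suc l) * v (suc l)) i)
    (cong₂ _+_
      (trans (f-cong (λ j → ℚₚ.*-comm (B j zero) (v zero)) i)
        (trans (f-* (v zero) (λ j → B j zero) i) (ℚₚ.*-comm (v zero) (f (λ j → B j zero) i))))
      (f-∑ (λ j l → B j (suc l)) (v ∘ suc) i))

  matrix : Matrix n m
  matrix i j = f (λ k → identity m k j) i

  matrix-*ᵥ : ∀ v i → (matrix *ᵥ v) i ≡ f v i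
  matrix-*ᵥ v i = trans (sym (f-∑ (identity m) v i)) (f-cong (∑-identityˡ v) i)

open IsLinear

record Automorphism (n : ℕ) : Set where
  field
    to from        : Vector ℚ n → Vector ℚ n
    to-linear      : IsLinear to
    from-linear    : IsLinear from
    to-from        : ∀ v i → to (from v) i ≡ v i
    from-to        : ∀ v i → from (to v) i ≡ v i

open Automorphism

infix 4 _⟦_⟧≈_

_⟦_⟧≈_ : Matrix r c → Automorphism r → Matrix r c → Set
A ⟦ φ ⟧≈ E = ∀ i j → to φ (λ k → A k j) i ≡ E i j

⟦⟧≈⇒rowEquivalent : (A E : Matrix r c) (φ : Automorphism r) → A ⟦ φ ⟧≈ E → RowEquivalent A E
⟦⟧≈⇒rowEquivalent A E φ φA≈E = P ,
  (Q , (λ i j → trans (matrix-*ᵥ (to-linear φ) (λ k → Q k j) i) (to-from φ (λ k → identity _ k j) i))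
     , (λ i j → trans (matrix-*ᵥ (from-linear φ) (λ k → P k j) i) (from-to φ (λ k → identity _ k j) i))) ,
  λ i j → trans (sym (φA≈E i j)) (sym (matrix-*ᵥ (to-linear φ) (λ k → A k j) i))
  where
  P = matrix (to-linear φ)
  Q = matrix (from-linear φ)

id-automorphism : Automorphism n
id-automorphism = record
  { to = id ; from = id ; to-linear = id-linear ; from-linear = id-linear
  ; to-from = λ _ _ → refl ; from-to = λ _ _ → refl }
  where
  id-linear : IsLinear id
  id-linear = record { f-cong = λ u≗v → u≗v ; f-+ = λ _ _ _ → refl ; f-* = λ _ _ _ → refl }

infixr 9 _∘ₐ_

∘-linear : {f : Vector ℚ m → Vector ℚ n} {g : Vector ℚ l → Vector ℚ m} →
           IsLinear f → IsLinear g → IsLinear (f ∘ g)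
∘-linear {f = f} {g} F G = record
  { f-cong = λ u≗v → f-cong F (f-cong G u≗v)
  ; f-+    = λ u v i → trans (f-cong F (f-+ G u v) i) (f-+ F (g u) (g v) i)
  ; f-*    = λ a v i → trans (f-cong F (f-* G a v) i) (f-* F a (g v) i) }

_∘ₐ_ : Automorphism n → Automorphism n → Automorphism n
φ ∘ₐ ψ = record
  { to          = to φ ∘ to ψ
  ; from        = from ψ ∘ from φ
  ; to-linear   = ∘-linear (to-linear φ) (to-linear ψ)
  ; from-linear = ∘-linear (from-linear ψ) (from-linear φ)
  ; to-from     = λ v i → trans (f-cong (to-linear φ) (to-from ψ (from φ v)) i) (to-from φ v i)
  ; from-to     = λ v i → trans (f-cong (from-linear ψ) (from-to φ (to ψ v)) i) (from-to ψ v i) }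

⟦∘⟧≈ : (A B C : Matrix r c) (φ ψ : Automorphism r) → A ⟦ ψ ⟧≈ B → B ⟦ φ ⟧≈ C → A ⟦ φ ∘ₐ ψ ⟧≈ C
⟦∘⟧≈ A B C φ ψ ψA≈B φB≈C i j = trans (f-cong (to-linear φ) (λ k → ψA≈B k j) i) (φB≈C i j)

-- This operation has two uses: it creates a pivot 1 in the first row, and it clears the first row
-- above the pivots of the rows below.
addToHead : Vector ℚ n → Vector ℚ (suc n) → Vector ℚ (suc n)
addToHead a v = (v zero + ∑ (λ i → a i * v (suc i))) ∷ᵥ (v ∘ suc)

addToHead-linear : (a : Vector ℚ n) → IsLinear (addToHead a)
addToHead-linear a = record { f-cong = congruent ; f-+ = additive ; f-* = homogeneous }
  where
  congruent : ∀ {u v} → (∀ i → u i ≡ v i) → ∀ i → addToHead a u i ≡ addToHead a v i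
  congruent u≗v zero    = cong₂ _+_ (u≗v zero) (∑-cong λ i → cong (a i *_) (u≗v (suc i)))
  congruent u≗v (suc i) = u≗v (suc i)

  additive : ∀ u v i → addToHead a (λ k → u k + v k) i ≡ addToHead a u i + addToHead a v i
  additive u v zero    = trans
    (cong (u zero + v zero +_) (trans
      (∑-cong λ i → ℚₚ.*-distribˡ-+ (a i) (u (suc i)) (v (suc i)))
      (∑-distrib-+ (λ i → a i * u (suc i)) (λ i → a i * v (suc i)))))
    (regroup (u zero) (v zero) (∑ λ i → a i * u (suc i)) (∑ λ i → a i * v (suc i)))
    where
    regroup : ∀ a b c d → (a + b) + (c + d) ≡ (a + c) + (b + d)
    regroup = solve 4 (λ a b c d → (a :+ b) :+ (c :+ d) := (a :+ c) :+ (b :+ d)) refl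
  additive u v (suc i) = refl

  homogeneous : ∀ b v i → addToHead a (λ k → b * v k) i ≡ b * addToHead a v i
  homogeneous b v zero    = trans
    (cong (b * v zero +_) (trans
      (∑-cong λ i → swap (a i) b (v (suc i)))
      (sym (*-distribˡ-sum b (λ i → a i * v (suc i))))))
    (sym (ℚₚ.*-distribˡ-+ b (v zero) (∑ λ i → a i * v (suc i))))
    where
    swap : ∀ a b c → a * (b * c) ≡ b * (a * c)
    swap = solve 3 (λ a b c → a :* (b :* c) := b :* (a :* c)) refl
  homogeneous b v (suc i) = refl

addToHead-inverse : (a b : Vector ℚ n) → (∀ i → a i + b i ≡ 0ℚ) →
                    ∀ v i → addToHead a (addToHead b v) i ≡ v i
addToHead-inverse a b a+b≗0 v zero    = begin
  (v zero + ∑ (λ i → b i * v (suc i))) + ∑ (λ i → a i * v (suc i))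
    ≡⟨ regroup (v zero) (∑ λ i → b i * v (suc i)) (∑ λ i → a i * v (suc i)) ⟩
  v zero + (∑ (λ i → a i * v (suc i)) + ∑ (λ i → b i * v (suc i)))
    ≡⟨ cong (v zero +_) (∑-distrib-+ (λ i → a i * v (suc i)) (λ i → b i * v (suc i))) ⟨
  v zero + ∑ (λ i → a i * v (suc i) + b i * v (suc i))
    ≡⟨ cong (v zero +_) (∑-zero λ i → trans (sym (ℚₚ.*-distribʳ-+ (v (suc i)) (a i) (b i)))
         (trans (cong (_* v (suc i)) (a+b≗0 i)) (ℚₚ.*-zeroˡ (v (suc i))))) ⟩
  v zero + 0ℚ
    ≡⟨ ℚₚ.+-identityʳ (v zero) ⟩
  v zero ∎
  where
  open ≡-Reasoning
  regroup : ∀ a b c → (a + b) + c ≡ a + (c + b)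
  regroup = solve 3 (λ a b c → (a :+ b) :+ c := a :+ (c :+ b)) refl
addToHead-inverse a b _ v (suc i) = refl

addToHead-automorphism : Vector ℚ n → Automorphism (suc n)
addToHead-automorphism a = record
  { to          = addToHead a
  ; from        = addToHead (-_ ∘ a)
  ; to-linear   = addToHead-linear a
  ; from-linear = addToHead-linear (-_ ∘ a)
  ; to-from     = addToHead-inverse a (-_ ∘ a) (ℚₚ.+-inverseʳ ∘ a)
  ; from-to     = addToHead-inverse (-_ ∘ a) a (ℚₚ.+-inverseˡ ∘ a) }

-- This operation clears the first column below the pivot.
addHead : Vector ℚ n → Vector ℚ (suc n) → Vector ℚ (suc n)
addHead a v = v zero ∷ᵥ λ i → v (suc i) + a i * v zero

addHead-linear : (a : Vector ℚ n) → IsLinear (addHead a)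
addHead-linear a = record { f-cong = congruent ; f-+ = additive ; f-* = homogeneous }
  where
  congruent : ∀ {u v} → (∀ i → u i ≡ v i) → ∀ i → addHead a u i ≡ addHead a v i
  congruent u≗v zero    = u≗v zero
  congruent u≗v (suc i) = cong₂ (λ x y → x + a i * y) (u≗v (suc i)) (u≗v zero)

  additive : ∀ u v i → addHead a (λ k → u k + v k) i ≡ addHead a u i + addHead a v i
  additive u v zero    = refl
  additive u v (suc i) = regroup (a i) (u (suc i)) (v (suc i)) (u zero) (v zero)
    where
    regroup : ∀ a b c d e → (b + c) + a * (d + e) ≡ (b + a * d) + (c + a * e)
    regroup = solve 5 (λ a b c d e →
      (b :+ c) :+ a :* (d :+ e) := (b :+ a :* d) :+ (c :+ a :* e)) refl

  homogeneous : ∀ b v i → addHead a (λ k → b * v k) i ≡ b * addHead a v i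
  homogeneous b v zero    = refl
  homogeneous b v (suc i) = regroup (a i) b (v (suc i)) (v zero)
    where
    regroup : ∀ a b c d → b * c + a * (b * d) ≡ b * (c + a * d)
    regroup = solve 4 (λ a b c d → b :* c :+ a :* (b :* d) := b :* (c :+ a :* d)) refl

addHead-automorphism : Vector ℚ n → Automorphism (suc n)
addHead-automorphism a = record
  { to          = addHead a
  ; from        = addHead (-_ ∘ a)
  ; to-linear   = addHead-linear a
  ; from-linear = addHead-linear (-_ ∘ a)
  ; to-from     = λ where
      v zero    → refl
      v (suc i) → cancel₁ (v (suc i)) (a i) (v zero)
  ; from-to     = λ where
      v zero    → refl
      v (suc i) → cancel₂ (v (suc i)) (a i) (v zero) }
  where
  cancel₁ : ∀ b a c → (b + - a * c) + a * c ≡ b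
  cancel₁ = solve 3 (λ b a c → (b :+ (:- a) :* c) :+ a :* c := b) refl
  cancel₂ : ∀ b a c → (b + a * c) + - a * c ≡ b
  cancel₂ = solve 3 (λ b a c → (b :+ a :* c) :+ (:- a) :* c := b) refl

scaleHead : ℚ → Vector ℚ (suc n) → Vector ℚ (suc n)
scaleHead s v = (s * v zero) ∷ᵥ (v ∘ suc)

scaleHead-linear : ∀ s → IsLinear (scaleHead {n} s)
scaleHead-linear s = record
  { f-cong = λ where
      u≗v zero    → cong (s *_) (u≗v zero)
      u≗v (suc i) → u≗v (suc i)
  ; f-+ = λ where
      u v zero    → ℚₚ.*-distribˡ-+ s (u zero) (v zero)
      u v (suc i) → refl
  ; f-* = λ where
      b v zero    → swap s b (v zero)
      b v (suc i) → refl }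
  where
  swap : ∀ a b c → a * (b * c) ≡ b * (a * c)
  swap = solve 3 (λ a b c → a :* (b :* c) := b :* (a :* c)) refl

scaleHead-inverse : ∀ s t → s * t ≡ 1ℚ → ∀ (v : Vector ℚ (suc n)) i →
                    scaleHead s (scaleHead t v) i ≡ v i
scaleHead-inverse s t st≡1 v zero    = trans (sym (ℚₚ.*-assoc s t (v zero)))
  (trans (cong (_* v zero) st≡1) (ℚₚ.*-identityˡ (v zero)))
scaleHead-inverse s t st≡1 v (suc i) = refl

scaleHead-automorphism : ∀ s t → s * t ≡ 1ℚ → Automorphism (suc n)
scaleHead-automorphism s t st≡1 = record
  { to          = scaleHead s
  ; from        = scaleHead t
  ; to-linear   = scaleHead-linear s
  ; from-linear = scaleHead-linear t
  ; to-from     = scaleHead-inverse s t st≡1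
  ; from-to     = scaleHead-inverse t s (trans (ℚₚ.*-comm t s) st≡1) }

onTail-linear : {f : Vector ℚ n → Vector ℚ n} → IsLinear f →
                IsLinear (λ (v : Vector ℚ (suc n)) → v zero ∷ᵥ f (v ∘ suc))
onTail-linear F = record
  { f-cong = λ where
      u≗v zero    → u≗v zero
      u≗v (suc i) → f-cong F (u≗v ∘ suc) i
  ; f-+ = λ where
      u v zero    → refl
      u v (suc i) → f-+ F (u ∘ suc) (v ∘ suc) i
  ; f-* = λ where
      b v zero    → refl
      b v (suc i) → f-* F b (v ∘ suc) i }

onTail : Automorphism n → Automorphism (suc n)
onTail φ = record
  { to          = λ v → v zero ∷ᵥ to φ (v ∘ suc)
  ; from        = λ v → v zero ∷ᵥ from φ (v ∘ suc)
  ; to-linear   = onTail-linear (to-linear φ)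
  ; from-linear = onTail-linear (from-linear φ)
  ; to-from     = λ where
      v zero    → refl
      v (suc i) → to-from φ (v ∘ suc) i
  ; from-to     = λ where
      v zero    → refl
      v (suc i) → from-to φ (v ∘ suc) i }

-- Leading entries and reduced row echelon forms

filter-suc : {P : Fin (suc n) → Set} (P? : ∀ j → Dec (P j)) (f : Fin k → Fin n) →
             filter P? (tabulate (Fin.suc ∘ f)) ≡ List.map Fin.suc (filter (P? ∘ Fin.suc) (tabulate f))
filter-suc {k = zero}  P? f = refl
filter-suc {k = suc k} P? f with P? (suc (f zero))
... | yes _ = cong (Fin.suc (f zero) ∷_) (filter-suc P? (f ∘ suc))
... | no  _ = filter-suc P? (f ∘ suc)

leading-zero : (v : Vector ℚ (suc n)) → v zero ≡ 0ℚ → leading v ≡ Maybe.map Fin.suc (leading (v ∘ suc))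
leading-zero v v₀≡0 with v zero ≟ 0ℚ
... | no  v₀≢0 = contradiction v₀≡0 v₀≢0
... | yes _    = trans (cong List.head (filter-suc (λ j → ¬? (v j ≟ 0ℚ)) id))
                       (head-map (nonzeros (v ∘ suc)))
  where
  head-map : ∀ {k} (js : List (Fin k)) → List.head (List.map Fin.suc js) ≡ Maybe.map Fin.suc (List.head js)
  head-map []       = refl
  head-map (j ∷ js) = refl

leading-nonzero : (v : Vector ℚ (suc n)) → v zero ≢ 0ℚ → leading v ≡ just zero
leading-nonzero v v₀≢0 with v zero ≟ 0ℚ
... | no  _    = refl
... | yes v₀≡0 = contradiction v₀≡0 v₀≢0

zeroColumn-isRREF : (E : Matrix r c) → IsRREF E → IsRREF (λ i → 0ℚ ∷ᵥ E i)
zeroColumn-isRREF {r} {c} E R = record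
  { zeroRowsLast   = λ {i} {i′} i<i′ eq → trans (lead i′)
      (cong (Maybe.map Fin.suc) (zeroRowsLast i<i′ (map-nothing (trans (sym (lead i)) eq))))
  ; pivotsIncrease = increase
  ; pivotIsOne     = one
  ; pivotColumn    = column }
  where
  open IsRREF R

  F : Matrix r (suc c)
  F i = 0ℚ ∷ᵥ E i

  lead : ∀ i → leading (F i) ≡ Maybe.map Fin.suc (leading (E i))
  lead i = leading-zero (F i) refl

  map-nothing : ∀ {m : Maybe (Fin c)} → Maybe.map Fin.suc m ≡ nothing → m ≡ nothing
  map-nothing {nothing} _ = refl

  map-just : ∀ {m : Maybe (Fin c)} {j} → Maybe.map Fin.suc m ≡ just j →
             ∃[ j′ ] m ≡ just j′ × j ≡ suc j′
  map-just {just j′} eq = j′ , refl , sym (just-injective eq)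

  pivot : ∀ i {j} → leading (F i) ≡ just j → ∃[ j′ ] leading (E i) ≡ just j′ × j ≡ suc j′
  pivot i eq = map-just {leading (E i)} (trans (sym (lead i)) eq)

  increase : ∀ {i i′ j j′} → i Fin.< i′ → leading (F i) ≡ just j → leading (F i′) ≡ just j′ → j Fin.< j′
  increase {i} {i′} i<i′ eq eq′ with pivot i eq | pivot i′ eq′
  ... | j , p , refl | j′ , p′ , refl = ℕ.s≤s (pivotsIncrease i<i′ p p′)

  one : ∀ {i j} → leading (F i) ≡ just j → F i j ≡ 1ℚ
  one {i} eq with pivot i eq
  ... | j , p , refl = pivotIsOne p

  column : ∀ {i j} → leading (F i) ≡ just j → ∀ i′ → i′ ≢ i → F i′ j ≡ 0ℚ
  column {i} eq with pivot i eq
  ... | j , p , refl = pivotColumn p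

1≢0 : 1ℚ ≢ 0ℚ
1≢0 ()

-- The new pivot sits in column 0, where F vanishes, so every pivot of F lies strictly to its right.
-- The last hypothesis supplies the missing zeros above the pivots of F.
prependPivotRow-isRREF : (u : Vector ℚ (suc c)) (F : Matrix r (suc c)) → IsRREF F →
  u zero ≡ 1ℚ → (∀ i → F i zero ≡ 0ℚ) → (∀ i {j} → leading (F i) ≡ just j → u j ≡ 0ℚ) →
  IsRREF (u ∷ᵥ F)
prependPivotRow-isRREF {c} {r} u F R u₀≡1 F₀≡0 u-cleared = record
  { zeroRowsLast   = zeroLast
  ; pivotsIncrease = increase
  ; pivotIsOne     = λ {i} → one {i}
  ; pivotColumn    = λ {i} → column {i} }
  where
  open IsRREF R

  E : Matrix (suc r) (suc c)
  E = u ∷ᵥ F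

  lead-u : leading u ≡ just zero
  lead-u = leading-nonzero u (λ u₀≡0 → 1≢0 (trans (sym u₀≡1) u₀≡0))

  zeroLast : ∀ {i i′} → i Fin.< i′ → leading (E i) ≡ nothing → leading (E i′) ≡ nothing
  zeroLast {zero}  {_}      _           eq with () ← trans (sym lead-u) eq
  zeroLast {suc i} {suc i′} (ℕ.s≤s i<i′) eq = zeroRowsLast i<i′ eq

  increase : ∀ {i i′ j j′} → i Fin.< i′ → leading (E i) ≡ just j → leading (E i′) ≡ just j′ → j Fin.< j′
  increase {zero} {suc i′} {j} {zero} _ eq eq′ =
    contradiction (trans (sym (pivotIsOne eq′)) (F₀≡0 i′)) 1≢0
  increase {zero} {suc i′} {j} {suc j′} _ eq eq′ with refl ← trans (sym lead-u) eq = ℕ.s≤s ℕ.z≤n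
  increase {suc i} {suc i′} (ℕ.s≤s i<i′) eq eq′ = pivotsIncrease i<i′ eq eq′

  one : ∀ {i j} → leading (E i) ≡ just j → E i j ≡ 1ℚ
  one {zero}  eq with refl ← trans (sym lead-u) eq = u₀≡1
  one {suc i} eq = pivotIsOne eq

  column : ∀ {i j} → leading (E i) ≡ just j → ∀ i′ → i′ ≢ i → E i′ j ≡ 0ℚ
  column {zero}  eq zero     0≢0 = contradiction refl 0≢0
  column {zero}  eq (suc i′) _ with refl ← trans (sym lead-u) eq = F₀≡0 i′
  column {suc i} eq zero     _ = u-cleared i eq
  column {suc i} eq (suc i′) i′≢i = pivotColumn eq i′ (i′≢i ∘ cong suc)

HasRREF : Matrix r c → Set
HasRREF {r} {c} A = ∃ λ (E : Matrix r c) → (∃[ φ ] A ⟦ φ ⟧≈ E) × IsRREF E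

hasRREF-⟦⟧≈ : (A B : Matrix r c) (φ : Automorphism r) → A ⟦ φ ⟧≈ B → HasRREF B → HasRREF A
hasRREF-⟦⟧≈ A B φ φA≈B (E , (ψ , ψB≈E) , R) = E , (ψ ∘ₐ φ , ⟦∘⟧≈ A B E ψ φ φA≈B ψB≈E) , R

-- With `d` the column below the pivot is cleared, with φ the remaining block is brought to echelon
-- form, and with `γ` the first row is cleared in the pivot columns of that block.
hasRREF-eliminate : (∀ (A : Matrix r c) → HasRREF A) →
                    (A : Matrix (suc r) (suc c)) → A zero zero ≡ 1ℚ → HasRREF A
hasRREF-eliminate {r} {c} hasRREF A A₀₀≡1 with
  hasRREF (λ i j → A (suc i) (suc j) + - A (suc i) zero * A zero (suc j))
... | E′ , (φ , φB≈E′) , R′ =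
  hasRREF-⟦⟧≈ A B (addHead-automorphism d) (λ _ _ → refl)
    (hasRREF-⟦⟧≈ B C (onTail φ) (λ _ _ → refl)
      (E , (addToHead-automorphism γ , C≈E) ,
        prependPivotRow-isRREF u F (zeroColumn-isRREF E′ R′) u₀≡1 (λ _ → refl) u-cleared))
  where
  d : Vector ℚ r
  d i = - A (suc i) zero

  B C : Matrix (suc r) (suc c)
  B i j = addHead d (λ k → A k j) i
  C i j = to (onTail φ) (λ k → B k j) i

  F : Matrix r (suc c)
  F i = 0ℚ ∷ᵥ E′ i

  C-tail : ∀ i j → C (suc i) j ≡ F i j
  C-tail i zero    = f-zero (to-linear φ) (λ k → trans
    (cong (λ e → A (suc k) zero + - A (suc k) zero * e) A₀₀≡1) (cancel (A (suc k) zero))) i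
    where
    cancel : ∀ b → b + - b * 1ℚ ≡ 0ℚ
    cancel = solve 1 (λ b → b :+ (:- b) :* con 1ℚ := con 0ℚ) refl
  C-tail i (suc j) = φB≈E′ i j

  -- In the pivot column of a row of F that row has a 1 and the other rows of F have 0, so this
  -- multiple cancels the entry of the first row there and no other multiple disturbs it. Zero rows
  -- contribute nothing.
  coefficient : Maybe (Fin (suc c)) → ℚ
  coefficient (just j) = - A zero j
  coefficient nothing  = 0ℚ

  γ : Vector ℚ r
  γ i = coefficient (leading (F i))

  u : Vector ℚ (suc c)
  u j = A zero j + ∑ λ i → γ i * F i j

  E : Matrix (suc r) (suc c)
  E = u ∷ᵥ F

  C≈E : C ⟦ addToHead-automorphism γ ⟧≈ E
  C≈E zero    j = cong (A zero j +_) (∑-cong λ i → cong (γ i *_) (C-tail i j))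
  C≈E (suc i) j = C-tail i j

  u₀≡1 : u zero ≡ 1ℚ
  u₀≡1 = cong₂ _+_ A₀₀≡1 (∑-zero λ i → ℚₚ.*-zeroʳ (γ i))

  module R = IsRREF (zeroColumn-isRREF E′ R′)

  u-cleared : ∀ i {j} → leading (F i) ≡ just j → u j ≡ 0ℚ
  u-cleared i {j} eq = begin
    A zero j + ∑ (λ k → γ k * F k j)
      ≡⟨ cong (A zero j +_) (∑-single i λ k k≢i →
           trans (cong (γ k *_) (R.pivotColumn {i} eq k k≢i)) (ℚₚ.*-zeroʳ (γ k))) ⟩
    A zero j + γ i * F i j
      ≡⟨ cong₂ (λ m e → A zero j + coefficient m * e) eq (R.pivotIsOne {i} eq) ⟩
    A zero j + - A zero j * 1ℚ
      ≡⟨ cancel (A zero j) ⟩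
    0ℚ ∎
    where
    open ≡-Reasoning
    cancel : ∀ b → b + - b * 1ℚ ≡ 0ℚ
    cancel = solve 1 (λ b → b :+ (:- b) :* con 1ℚ := con 0ℚ) refl

-- Induction on the columns. The first column either receives a pivot 1 in the first row, by an
-- addition or by a scaling, or it is zero and all rows pass to the remaining columns.
hasRREF : ∀ c {r} (A : Matrix r c) → HasRREF A
hasRREF zero    A = A , (id-automorphism , λ _ _ → refl) , record
  { zeroRowsLast   = λ _ _ → refl
  ; pivotsIncrease = λ { {j = ()} }
  ; pivotIsOne     = λ { {j = ()} }
  ; pivotColumn    = λ { {j = ()} } }
hasRREF (suc c) {zero} A = A , (id-automorphism , λ _ _ → refl) , record
  { zeroRowsLast   = λ { {()} }
  ; pivotsIncrease = λ { {()} }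
  ; pivotIsOne     = λ { {()} }
  ; pivotColumn    = λ { {()} } }
hasRREF (suc c) {suc r} A
  with Finₚ.any? (λ i → ¬? (A (suc i) zero ≟ 0ℚ)) | A zero zero ≟ 0ℚ
... | yes (i , Aᵢ₀≢0) | _ =
  hasRREF-⟦⟧≈ A B (addToHead-automorphism γ) (λ _ _ → refl)
    (hasRREF-eliminate (hasRREF c) B B₀₀≡1)
  where
  instance
    nz : NonZero (A (suc i) zero)
    nz = ≢-nonZero Aᵢ₀≢0

  -- The factor solves A₀₀ + s Aᵢ₀ = 1 for the entries of the first column, Aᵢ₀ being the nonzero
  -- one found below the first row. Adding that row therefore makes a pivot 1 without exchanging
  -- rows.
  s : ℚ
  s = (1ℚ - A zero zero) * 1/ A (suc i) zero

  γ : Vector ℚ r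
  γ k = s * identity r i k

  B : Matrix (suc r) (suc c)
  B k j = addToHead γ (λ l → A l j) k

  B₀₀≡1 : B zero zero ≡ 1ℚ
  B₀₀≡1 = begin
    A zero zero + ∑ (λ k → s * identity r i k * A (suc k) zero)
      ≡⟨ cong (A zero zero +_) (∑-cong λ k → ℚₚ.*-assoc s (identity r i k) (A (suc k) zero)) ⟩
    A zero zero + ∑ (λ k → s * (identity r i k * A (suc k) zero))
      ≡⟨ cong (A zero zero +_) (*-distribˡ-sum s (λ k → identity r i k * A (suc k) zero)) ⟨
    A zero zero + s * ∑ (λ k → identity r i k * A (suc k) zero)
      ≡⟨ cong (λ e → A zero zero + s * e) (∑-identityˡ (λ k → A (suc k) zero) i) ⟩
    A zero zero + s * A (suc i) zero
      ≡⟨ cong (A zero zero +_) (ℚₚ.*-assoc (1ℚ - A zero zero) (1/ A (suc i) zero) (A (suc i) zero)) ⟩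
    A zero zero + (1ℚ - A zero zero) * (1/ A (suc i) zero * A (suc i) zero)
      ≡⟨ cong (λ e → A zero zero + (1ℚ - A zero zero) * e) (ℚₚ.*-inverseˡ (A (suc i) zero)) ⟩
    A zero zero + (1ℚ - A zero zero) * 1ℚ
      ≡⟨ cancel (A zero zero) ⟩
    1ℚ ∎
    where
    open ≡-Reasoning
    cancel : ∀ b → b + (1ℚ - b) * 1ℚ ≡ 1ℚ
    cancel = solve 1 (λ b → b :+ (con 1ℚ :- b) :* con 1ℚ := con 1ℚ) refl
... | no _ | no A₀₀≢0 =
  hasRREF-⟦⟧≈ A B (scaleHead-automorphism (1/ A zero zero) (A zero zero) A₀₀⁻¹A₀₀≡1) (λ _ _ → refl)
    (hasRREF-eliminate (hasRREF c) B A₀₀⁻¹A₀₀≡1)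
  where
  instance
    nz : NonZero (A zero zero)
    nz = ≢-nonZero A₀₀≢0

  A₀₀⁻¹A₀₀≡1 : 1/ A zero zero * A zero zero ≡ 1ℚ
  A₀₀⁻¹A₀₀≡1 = ℚₚ.*-inverseˡ (A zero zero)

  B : Matrix (suc r) (suc c)
  B k j = scaleHead (1/ A zero zero) (λ l → A l j) k
... | no ∄i | yes A₀₀≡0 with hasRREF c (λ i j → A i (suc j))
... | E′ , (φ , φA≈E′) , R′ = (λ i → 0ℚ ∷ᵥ E′ i) , (φ , φA≈E) , zeroColumn-isRREF E′ R′
  where
  column≡0 : ∀ i → A i zero ≡ 0ℚ
  column≡0 zero    = A₀₀≡0
  column≡0 (suc i) with A (suc i) zero ≟ 0ℚ
  ... | yes eq  = eq
  ... | no  neq = contradiction (i , neq) ∄i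

  φA≈E : A ⟦ φ ⟧≈ (λ i → 0ℚ ∷ᵥ E′ i)
  φA≈E i zero    = f-zero (to-linear φ) column≡0 i
  φA≈E i (suc j) = φA≈E′ i j

rref-exists : (A : Matrix r c) → ∃[ E ] RowEquivalent A E × IsRREF E
rref-exists A =
  let E , (φ , φA≈E) , R = hasRREF _ A in E , ⟦⟧≈⇒rowEquivalent A E φ φA≈E , R

-- Row selection by pivots

leading-nothing : (v : Vector ℚ n) → leading v ≡ nothing → ∀ j → v j ≡ 0ℚ
leading-nothing {suc n} v eq = go (v zero ≟ 0ℚ)
  where
  map-nothing : ∀ {m : Maybe (Fin n)} → Maybe.map Fin.suc m ≡ nothing → m ≡ nothing
  map-nothing {nothing} _ = refl

  go : Dec (v zero ≡ 0ℚ) → ∀ j → v j ≡ 0ℚ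
  go (no  v₀≢0) j with () ← trans (sym (leading-nonzero v v₀≢0)) eq
  go (yes v₀≡0) zero    = v₀≡0
  go (yes v₀≡0) (suc j) =
    leading-nothing (v ∘ suc) (map-nothing (trans (sym (leading-zero v v₀≡0)) eq)) j

mapMaybe-tabulate : {A B : Set} (f : A → Maybe B) (g : Fin n → A) (h : Fin n → B) →
                    (∀ i → f (g i) ≡ just (h i)) → mapMaybe f (tabulate g) ≡ tabulate h
mapMaybe-tabulate {zero}  f g h eq = refl
mapMaybe-tabulate {suc n} f g h eq with f (g zero) | eq zero
... | .(just (h zero)) | refl = cong (h zero ∷_) (mapMaybe-tabulate f (g ∘ suc) (h ∘ suc) (eq ∘ suc))

transpose-inverse : (P Q : Matrix n n) → IsInverse P Q → IsInverse (transpose Q) (transpose P)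
transpose-inverse P Q (PQ≈1 , QP≈1) =
  (λ i j → trans (∑-cong λ k → ℚₚ.*-comm (Q k i) (P j k)) (trans (PQ≈1 j i) (identity-sym j i))) ,
  (λ i j → trans (∑-cong λ k → ℚₚ.*-comm (P k i) (Q j k)) (trans (QP≈1 j i) (identity-sym j i)))

-- The number of selected rows is the length of a computed list and equals the number of columns
-- only by a proof; matching on that proof turns the cast into the identity.
reindexed-squareWithInverse : (m≡n : m ≡ n) (A : Matrix m n) (P Q : Matrix n n) → IsInverse P Q →
  (∀ i j → A i j ≡ P (cast m≡n i) j) → ∃ (SquareWithInverse A)
reindexed-squareWithInverse refl A P Q (PQ≈1 , QP≈1) A≗P = Q , refl ,
  (λ i j → trans (∑-cong λ k → cong (_* Q k j) (A≈P i k)) (PQ≈1 i j)) ,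
  (λ i j → trans (∑-cong λ k → cong (Q i k *_) (A≈P k j)) (QP≈1 i j))
  where
  A≈P : A ≈ₘ P
  A≈P i j = trans (A≗P i j) (cong (λ k → P k j) (Finₚ.cast-is-id refl i))

module _ {A : Matrix r c} {B : Matrix c r} (BA≈1 : B *ₘ A ≈ₘ identity c)
         {E : Matrix c r} (P Q : Matrix c c) (PQ-inv : IsInverse P Q)
         (E≈PAᵀ : E ≈ₘ P *ₘ transpose A) (R : IsRREF E) where

  open IsRREF R

  -- From B A = 1 it follows that P = P Aᵀ Bᵀ = E Bᵀ. A zero row of E would thus be a zero row of P,
  -- against P Q = 1.
  no-zero-row : ∀ i → leading (E i) ≢ nothing
  no-zero-row i eq = 1≢0 (trans (sym (identity-diagonal {i = i} refl))
    (trans (sym (proj₁ PQ-inv i i))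
      (∑-zero λ l → trans (cong (_* Q l i) (P-row≡0 l)) (ℚₚ.*-zeroˡ (Q l i)))))
    where
    open ≡-Reasoning
    P-row≡0 : ∀ l → P i l ≡ 0ℚ
    P-row≡0 l = begin
      P i l
        ≡⟨ ∑-identityʳ (P i) l ⟨
      ∑ (λ k → P i k * identity c k l)
        ≡⟨ ∑-cong (λ k → cong (P i k *_) (trans (identity-sym k l) (trans (sym (BA≈1 l k))
             (∑-cong λ m → ℚₚ.*-comm (B l m) (A m k))))) ⟩
      ∑ (λ k → P i k * ∑ (λ m → A m k * B l m))
        ≡⟨ ∑-assoc (P i) (transpose A) (B l) ⟨
      ∑ (λ m → ∑ (λ k → P i k * A m k) * B l m)
        ≡⟨ ∑-zero (λ m → trans (cong (_* B l m) (trans (sym (E≈PAᵀ i m)) (leading-nothing (E i) eq m)))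
             (ℚₚ.*-zeroˡ (B l m))) ⟩
      0ℚ ∎

  pivot : ∀ i → ∃[ j ] leading (E i) ≡ just j
  pivot i with leading (E i) in eq
  ... | just j  = j , refl
  ... | nothing = contradiction eq (no-zero-row i)

  pivotOf : Fin c → Fin r
  pivotOf = proj₁ ∘ pivot

  E-pivot : ∀ i j → E i (pivotOf j) ≡ identity c i j
  E-pivot i j with i Finₚ.≟ j
  ... | yes refl = pivotIsOne (proj₂ (pivot j))
  ... | no  i≢j  = pivotColumn (proj₂ (pivot j)) i i≢j

  -- Since Aᵀ = Q E and column `pivotOf i` of E is the i-th unit vector, that column of Aᵀ is column
  -- i of Q.
  A-pivot : ∀ i j → A (pivotOf i) j ≡ Q j i
  A-pivot i j = begin
    A (pivotOf i) j
      ≡⟨ *ᵥ-left-inverse P Q (proj₂ PQ-inv) (A (pivotOf i)) j ⟨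
    ∑ (λ k → Q j k * ∑ (λ l → P k l * A (pivotOf i) l))
      ≡⟨ ∑-cong (λ k → cong (Q j k *_) (trans (sym (E≈PAᵀ k (pivotOf i))) (E-pivot k i))) ⟩
    ∑ (λ k → Q j k * identity c k i)
      ≡⟨ ∑-identityʳ (Q j) i ⟩
    Q j i ∎
    where open ≡-Reasoning

  pivot-rows-invertible : ∃ (SquareWithInverse (A ∘ lookup (pivots E)))
  -- Every row of E has a pivot, so `mapMaybe` discards nothing and the list of pivots has exactly
  -- one entry per row.
  pivot-rows-invertible = subst (λ js → ∃ (SquareWithInverse (A ∘ lookup js)))
    (sym (mapMaybe-tabulate (leading ∘ E) id pivotOf (proj₂ ∘ pivot)))
    (reindexed-squareWithInverse len (A ∘ lookup (tabulate pivotOf))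
      (transpose Q) (transpose P) (transpose-inverse P Q PQ-inv)
      λ i j → trans (cong (λ k → A k j) (lookup-pivots i)) (A-pivot (cast len i) j))
    where
    len : length (tabulate pivotOf) ≡ c
    len = Listₚ.length-tabulate pivotOf

    lookup-pivots : ∀ i → lookup (tabulate pivotOf) i ≡ pivotOf (cast len i)
    lookup-pivots i = trans
      (cong (lookup (tabulate pivotOf)) (sym (Finₚ.cast-involutive (sym len) len i)))
      (Listₚ.lookup-tabulate pivotOf (cast len i))

selected-rows-invertible : (em : ExcludedMiddle 0ℓ) (A : Matrix r c) (B : Matrix c r) →
  B *ₘ A ≈ₘ identity c → ∃ (SquareWithInverse (A ∘ lookup (pivots (rref em (transpose A)))))
selected-rows-invertible em A B BA≈1 =
  -- As an echelon form exists, the matrix picked by `rref` satisfies the specification, whichever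
  -- one it is.
  let (P , (Q , PQ-inv) , E≈PAᵀ) , R =
        choose-satisfies em {P = λ E → RowEquivalent (transpose A) E × IsRREF E}
          (transpose A) (proj₂ (rref-exists (transpose A)))
  in pivot-rows-invertible {A = A} {B} BA≈1 P Q PQ-inv E≈PAᵀ R

-- Correctness of the algorithm

∑-nonneg : {f : Vector ℚ n} → (∀ i → 0ℚ ≤ f i) → 0ℚ ≤ ∑ f
∑-nonneg {zero}  0≤f = ℚₚ.≤-refl
∑-nonneg {suc n} 0≤f = ℚₚ.+-mono-≤ (0≤f zero) (∑-nonneg (0≤f ∘ suc))

term≤∑ : {f : Vector ℚ n} → (∀ i → 0ℚ ≤ f i) → ∀ i → f i ≤ ∑ f
term≤∑ {suc n} {f} 0≤f zero    = ℚₚ.≤-trans (ℚₚ.≤-reflexive (sym (ℚₚ.+-identityʳ (f zero))))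
  (ℚₚ.+-monoʳ-≤ (f zero) (∑-nonneg (0≤f ∘ suc)))
term≤∑ {suc n} {f} 0≤f (suc i) = ℚₚ.≤-trans (ℚₚ.≤-reflexive (sym (ℚₚ.+-identityˡ (f (suc i)))))
  (ℚₚ.+-mono-≤ (0≤f zero) (term≤∑ (0≤f ∘ suc) i))

identity-nonneg : ∀ (i j : Fin n) → 0ℚ ≤ identity n i j
identity-nonneg i j with i Finₚ.≟ j
... | yes _ = ℚₚ.nonNegative⁻¹ 1ℚ
... | no  _ = ℚₚ.≤-refl

-- The number of a with g a = j. Written with entries of the identity matrix, it lets `∑-fibers` be
-- proved by inserting that matrix and exchanging two sums. For the map from roots to columns it is
-- the solution of the linear system.
fiberSize : (Fin m → Fin n) → Vector ℚ n
fiberSize {n = n} g j = ∑ λ a → identity n j (g a)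

-- The summands are nonnegative and the one at a is 1, so the sum is at least 1.
fiberSize≢0 : (g : Fin m → Fin n) → ∀ a → fiberSize g (g a) ≢ 0ℚ
fiberSize≢0 {n = n} g a size≡0 = 1≢0 (ℚₚ.≤-antisym
  (ℚₚ.≤-trans (ℚₚ.≤-reflexive (sym (identity-diagonal {i = g a} refl)))
    (ℚₚ.≤-trans (term≤∑ (λ b → identity-nonneg (g a) (g b)) a) (ℚₚ.≤-reflexive size≡0)))
  (ℚₚ.nonNegative⁻¹ 1ℚ))

fiberSize≢0⇒∃ : (g : Fin m → Fin n) → ∀ j → fiberSize g j ≢ 0ℚ → ∃[ a ] j ≡ g a
fiberSize≢0⇒∃ g j size≢0 with Finₚ.any? (λ a → j Finₚ.≟ g a)
... | yes ∃a = ∃a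
... | no  ∄a = contradiction (∑-zero λ a → identity-off-diagonal λ e → ∄a (a , e)) size≢0

-- Grouping by the value of g. With h a row of M, a sum of signs over the roots becomes an entry of
-- M w.
∑-fibers : (h : Vector ℚ n) (g : Fin m → Fin n) → ∑ (h ∘ g) ≡ ∑ λ j → h j * fiberSize g j
∑-fibers {n} h g = begin
  ∑ (λ a → h (g a))                           ≡⟨ ∑-cong (λ a → sym (∑-identityʳ h (g a))) ⟩
  ∑ (λ a → ∑ λ j → h j * identity n j (g a))  ≡⟨ ∑-comm (λ a j → h j * identity n j (g a)) ⟩
  ∑ (λ j → ∑ λ a → h j * identity n j (g a))
    ≡⟨ ∑-cong (λ j → sym (*-distribˡ-sum (h j) (λ a → identity n j (g a)))) ⟩
  ∑ (λ j → h j * fiberSize g j)               ∎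
  where open ≡-Reasoning

-- The inverse used by `solveLinear` may differ from the given one, but any left inverse of M
-- recovers w from M w.
solveLinear-correct : (em : ExcludedMiddle 0ℓ) (default : ∀ n → Vector ℚ n)
  (M : Matrix r c) {v : Vector ℚ r} {w : Vector ℚ c} → ∃ (SquareWithInverse M) →
  (∀ i → v i ≡ (M *ᵥ w) i) → ∀ j → solveLinear em default M v j ≡ w j
solveLinear-correct em default M {v} {w} inv v≗Mw j with em {∃ (SquareWithInverse M)}
... | yes (M⁻¹ , _ , _ , M⁻¹M≈1) =
  trans (∑-cong λ k → cong (M⁻¹ j k *_) (v≗Mw k)) (*ᵥ-left-inverse M M⁻¹ M⁻¹M≈1 w j)
... | no ∄inv = contradiction inv ∄inv

++-injective : {A : Set} (xs ys : List A) {zs ws : List A} → length xs ≡ length ys →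
               xs ++ zs ≡ ys ++ ws → xs ≡ ys × zs ≡ ws
++-injective []       []       _  eq = refl , eq
++-injective (x ∷ xs) (y ∷ ys) ln eq =
  let x≡y , eq′ = Listₚ.∷-injective eq
      xs≡ys , zs≡ws = ++-injective xs ys (ℕₚ.suc-injective ln) eq′
  in cong₂ _∷_ x≡y xs≡ys , zs≡ws

nth-++ˡ : ∀ qs₁ qs₂ {k} → k ℕ.< length qs₁ → nth (qs₁ ++ qs₂) k ≡ nth qs₁ k
nth-++ˡ (q ∷ qs₁) qs₂ {zero}  _           = refl
nth-++ˡ (q ∷ qs₁) qs₂ {suc k} (ℕ.s≤s k<l) = nth-++ˡ qs₁ qs₂ k<l

nth-++ʳ : ∀ qs₁ qs₂ k → nth (qs₁ ++ qs₂) (length qs₁ ℕ.+ k) ≡ nth qs₂ k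
nth-++ʳ []        qs₂ k = refl
nth-++ʳ (q ∷ qs₁) qs₂ k = nth-++ʳ qs₁ qs₂ k

module _ (em : ExcludedMiddle 0ℓ) where

  signs : List Poly → ℝ → SignVector
  signs qs x = map (λ q → sgn em (eval q x)) qs

  signs-cong : ∀ qs {x y} → x ≃ y → signs qs x ≡ signs qs y
  signs-cong qs {x} {y} x≃y =
    Listₚ.map-cong (λ q → sgn-cong em {eval q x} {eval q y} (eval-cong q {x} {y} x≃y)) qs

  polySign : Poly → ℝ → ℚ
  polySign q x = signℚ (sgn em (eval q x))

  polySign-*ₚ : ∀ p q x → polySign (p *ₚ q) x ≡ polySign p x * polySign q x
  polySign-*ₚ p q x = trans
    (cong signℚ (sgn-cong em {eval (p *ₚ q) x} {eval p x *ᵣ eval q x}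
      (≐⇒≃ {eval (p *ₚ q) x} {eval p x *ᵣ eval q x} (eval-*ₚ p q x))))
    (signℚ-* em (eval p x) (eval q x))

  polySign-1ₚ : ∀ x → polySign 1ₚ x ≡ 1ℚ
  polySign-1ₚ x = cong signℚ (trans
    (sgn-cong em {eval 1ₚ x} {1ᵣ} (≐⇒≃ {eval 1ₚ x} {1ᵣ} (eval-1ₚ x))) (sgn-pos em {1ᵣ} 0<1ᵣ))

  polySign-productₚ-++ : ∀ ps qs x →
    polySign (productₚ (ps ++ qs)) x ≡ polySign (productₚ ps) x * polySign (productₚ qs) x
  polySign-productₚ-++ []       qs x = sym (trans
    (cong (_* polySign (productₚ qs) x) (polySign-1ₚ x)) (ℚₚ.*-identityˡ (polySign (productₚ qs) x)))
  polySign-productₚ-++ (p ∷ ps) qs x = trans (polySign-*ₚ p (productₚ (ps ++ qs)) x)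
    (trans (cong (polySign p x *_) (polySign-productₚ-++ ps qs x))
      (trans (sym (ℚₚ.*-assoc (polySign p x) (polySign (productₚ ps) x) (polySign (productₚ qs) x)))
        (cong (_* polySign (productₚ qs) x) (sym (polySign-*ₚ p (productₚ ps) x)))))

  subproduct : List Poly → List ℕ → Poly
  subproduct qs I = productₚ (map (nth qs) I)

  -- The bound on I makes its indices refer to `qs₁` even inside the concatenation, while the
  -- shifted indices of J land in `qs₂`. The field `indices` of `Adequate` exists to provide this
  -- bound.
  polySign-subproduct-++ : ∀ qs₁ qs₂ {I} J x → All (ℕ._< length qs₁) I →
    polySign (subproduct (qs₁ ++ qs₂) (I ++ map (length qs₁ ℕ.+_) J)) x ≡
    polySign (subproduct qs₁ I) x * polySign (subproduct qs₂ J) x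
  polySign-subproduct-++ qs₁ qs₂ {I} J x I<l = trans
    (cong (λ ps → polySign (productₚ ps) x) (trans
      (Listₚ.map-++ (nth (qs₁ ++ qs₂)) I (map (length qs₁ ℕ.+_) J))
      (cong₂ _++_
        (Listₚ.map-cong-local (All.map (nth-++ˡ qs₁ qs₂) I<l))
        (trans (sym (Listₚ.map-∘ J)) (Listₚ.map-cong (nth-++ʳ qs₁ qs₂) J)))))
    (polySign-productₚ-++ (map (nth qs₁) I) (map (nth qs₂) J) x)

  module _ (default : ∀ n → Vector ℚ n) (p : Poly) where

    -- The matrix entries are constrained only in columns of realized sign vectors.
    record Adequate (qs : List Poly) (d : SignData) : Set where
      open SignData d
      field
        invertible : ∃ (SquareWithInverse M)
        indices    : ∀ i → All (ℕ._< length qs) (S i)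
        injective  : ∀ {j j′} → Σ j ≡ Σ j′ → j ≡ j′
        complete   : ∀ x → Root p x → ∃[ j ] Σ j ≡ signs qs x ×
                     (∀ i → M i j ≡ polySign (subproduct qs (S i)) x)

    record Exact (qs : List Poly) (d : SignData) : Set where
      open SignData d
      field
        adequate : Adequate qs d
        realized : ∀ j → ∃[ x ] Root p x × Σ j ≡ signs qs x
      open Adequate adequate public

    base-adequate : ∀ q → (∀ x → Root p x → ¬ eval q x ≃ 0ᵣ) → Adequate [ q ] base
    base-adequate q q≄0 = record
      { invertible = base⁻¹ , refl , M*base⁻¹≈1 , base⁻¹*M≈1
      ; indices    = λ { 0F → [] ; 1F → ℕ.s≤s ℕ.z≤n ∷ [] }
      ; injective  = λ {j} {j′} → injective j j′
      ; complete   = complete }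
      where
      open SignData base

      base⁻¹ : Matrix 2 2
      base⁻¹ 0F 0F = ½
      base⁻¹ 0F 1F = ½
      base⁻¹ 1F 0F = ½
      base⁻¹ 1F 1F = - ½

      M*base⁻¹≈1 : M *ₘ base⁻¹ ≈ₘ identity 2
      M*base⁻¹≈1 0F 0F = refl
      M*base⁻¹≈1 0F 1F = refl
      M*base⁻¹≈1 1F 0F = refl
      M*base⁻¹≈1 1F 1F = refl

      base⁻¹*M≈1 : base⁻¹ *ₘ M ≈ₘ identity 2
      base⁻¹*M≈1 0F 0F = refl
      base⁻¹*M≈1 0F 1F = refl
      base⁻¹*M≈1 1F 0F = refl
      base⁻¹*M≈1 1F 1F = refl

      injective : ∀ j j′ → Σ j ≡ Σ j′ → j ≡ j′
      injective 0F 0F _ = refl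
      injective 0F 1F ()
      injective 1F 0F ()
      injective 1F 1F _ = refl

      entry : ∀ x {s} → sgn em (eval q x) ≡ s → signℚ s ≡ polySign (subproduct [ q ] [ 0 ]) x
      entry x {s} eq = sym (trans (polySign-*ₚ q 1ₚ x)
        (trans (cong₂ (λ s t → signℚ s * t) eq (polySign-1ₚ x)) (ℚₚ.*-identityʳ (signℚ s))))

      complete : ∀ x → Root p x → ∃[ j ] Σ j ≡ signs [ q ] x ×
                 (∀ i → M i j ≡ polySign (subproduct [ q ] (S i)) x)
      complete x root with trichotomy em (eval q x)
      ... | inj₁ q<0 = 1F , cong [_] (sym (sgn-neg em {eval q x} q<0)) , λ where
        0F → sym (polySign-1ₚ x)
        1F → entry x (sgn-neg em {eval q x} q<0)
      ... | inj₂ (inj₁ q≃0) = contradiction q≃0 (q≄0 x root)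
      ... | inj₂ (inj₂ 0<q) = 0F , cong [_] (sym (sgn-pos em {eval q x} 0<q)) , λ where
        0F → sym (polySign-1ₚ x)
        1F → entry x (sgn-pos em {eval q x} 0<q)

    combine-adequate : ∀ qs₁ d₁ qs₂ d₂ → Exact qs₁ d₁ → Exact qs₂ d₂ →
                       Adequate (qs₁ ++ qs₂) (proj₂ (combine (qs₁ , d₁) (qs₂ , d₂)))
    combine-adequate qs₁ d₁@(mkSignData {r₁} {c₁} M₁ S₁ Σ₁)
                     qs₂ d₂@(mkSignData {r₂} {c₂} M₂ S₂ Σ₂) e₁ e₂ = record
      { invertible = ⊗-squareWithInverse M₁ M₂ E₁.invertible E₂.invertible
      ; indices    = λ i → Allₚ.++⁺
          (All.map (λ k<l → ℕₚ.<-≤-trans k<l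
              (ℕₚ.≤-trans (ℕₚ.m≤m+n (length qs₁) (length qs₂)) (ℕₚ.≤-reflexive (sym length-++))))
            (E₁.indices (proj₁ (remQuot {r₁} r₂ i))))
          (Allₚ.map⁺ (All.map (λ k<l → ℕₚ.<-≤-trans (ℕₚ.+-monoʳ-< (length qs₁) k<l)
              (ℕₚ.≤-reflexive (sym length-++)))
            (E₂.indices (proj₂ (remQuot {r₁} r₂ i)))))
      ; injective  = injective
      ; complete   = complete }
      where
      module E₁ = Exact e₁
      module E₂ = Exact e₂
      open SignData (proj₂ (combine (qs₁ , d₁) (qs₂ , d₂)))

      length-++ : length (qs₁ ++ qs₂) ≡ length qs₁ ℕ.+ length qs₂
      length-++ = Listₚ.length-++ qs₁

      -- A concatenation can be split uniquely only if the left parts have equal length. This length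
      -- comes from `realized`, which is why the two halves must be exact and not merely adequate.
      length-Σ₁ : ∀ j → length (Σ₁ j) ≡ length qs₁
      length-Σ₁ j = let x , _ , eq = E₁.realized j in
        trans (cong length eq) (Listₚ.length-map (λ q → sgn em (eval q x)) qs₁)

      injective : ∀ {j j′} → Σ j ≡ Σ j′ → j ≡ j′
      injective {j} {j′} eq =
        let eq₁ , eq₂ = ++-injective (Σ₁ (proj₁ (remQuot {c₁} c₂ j))) (Σ₁ (proj₁ (remQuot {c₁} c₂ j′)))
              (trans (length-Σ₁ (proj₁ (remQuot {c₁} c₂ j))) (sym (length-Σ₁ (proj₁ (remQuot {c₁} c₂ j′))))) eq
        in trans (sym (Finₚ.combine-remQuot {c₁} c₂ j))
             (trans (cong₂ Fin.combine (E₁.injective eq₁) (E₂.injective eq₂))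
               (Finₚ.combine-remQuot {c₁} c₂ j′))

      complete : ∀ x → Root p x → ∃[ j ] Σ j ≡ signs (qs₁ ++ qs₂) x ×
                 (∀ i → M i j ≡ polySign (subproduct (qs₁ ++ qs₂) (S i)) x)
      complete x root =
        let j₁ , Σ₁≡ , M₁≡ = E₁.complete x root
            j₂ , Σ₂≡ , M₂≡ = E₂.complete x root
            j≡ = Finₚ.remQuot-combine {c₁} {c₂} j₁ j₂
        in Fin.combine j₁ j₂ ,
           trans (cong (λ (a , b) → Σ₁ a ++ Σ₂ b) j≡)
             (trans (cong₂ _++_ Σ₁≡ Σ₂≡) (sym (Listₚ.map-++ (λ q → sgn em (eval q x)) qs₁ qs₂))) ,
           λ i → let i₁ = proj₁ (remQuot {r₁} r₂ i); i₂ = proj₂ (remQuot {r₁} r₂ i) in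
             trans (cong (λ (a , b) → M₁ i₁ a * M₂ i₂ b) j≡)
               (trans (cong₂ _*_ (M₁≡ i₁) (M₂≡ i₂))
                 (sym (polySign-subproduct-++ qs₁ qs₂ (S₂ i₂) x (E₁.indices i₁))))

    select-exact : ∀ qs {r c} {M : Matrix r c} {S Σ} (kept : List (Fin c)) →
      Adequate qs (mkSignData M S Σ) →
      (∀ {k k′} → lookup kept k ≡ lookup kept k′ → k ≡ k′) →
      (∀ k → ∃[ x ] Root p x × Σ (lookup kept k) ≡ signs qs x) →
      (∀ x → Root p x → ∀ j → Σ j ≡ signs qs x → ∃[ k ] lookup kept k ≡ j) →
      let A = λ i k → M i (lookup kept k)
          R = pivots (rref em (transpose A))
      in Exact qs (mkSignData (A ∘ lookup R) (S ∘ lookup R) (Σ ∘ lookup kept))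
    select-exact qs {r} {c} {M} {S} {Σ} kept adq kept-injective kept-realized kept-complete = record
      { adequate = record
        { invertible = selected-rows-invertible em A (M⁻¹ ∘ lookup kept) M⁻¹A≈1
        ; indices    = λ i → indices (lookup R i)
        ; injective  = λ eq → kept-injective (injective eq)
        ; complete   = complete′ }
      ; realized = kept-realized }
      where
      open Adequate adq

      A : Matrix r (length kept)
      A i k = M i (lookup kept k)

      R : List (Fin r)
      R = pivots (rref em (transpose A))

      M⁻¹ : Matrix c r
      M⁻¹ = proj₁ invertible

      -- Keeping the same indices among the rows of M⁻¹ as among the columns of M selects a
      -- submatrix of the identity, which is an identity again because `kept` has no repetitions.
      M⁻¹A≈1 : (M⁻¹ ∘ lookup kept) *ₘ A ≈ₘ identity (length kept)
      M⁻¹A≈1 k k′ = trans (proj₂ (proj₂ (proj₂ invertible)) (lookup kept k) (lookup kept k′))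
        (identity-injection (lookup kept) kept-injective k k′)

      complete′ : ∀ x → Root p x → ∃[ k ] Σ (lookup kept k) ≡ signs qs x ×
                  (∀ i → A (lookup R i) k ≡ polySign (subproduct qs (S (lookup R i))) x)
      complete′ x root =
        let j , Σj≡ , Mj≡ = complete x root
            k , lookup≡   = kept-complete x root j Σj≡
        in k , trans (cong Σ lookup≡) Σj≡ ,
           λ i → trans (cong (M (lookup R i)) lookup≡) (Mj≡ (lookup R i))

    module _ {N : ℕ} (roots : IsCardinality (Root p) N) where

      f : Fin N → ℝ
      f = proj₁ roots

      f-root : ∀ a → Root p (f a)
      f-root = proj₁ (proj₂ roots)

      module _ qs {r c} {M : Matrix r c} {S Σ} (adq : Adequate qs (mkSignData M S Σ)) where
        open Adequate adq

        column : Fin N → Fin c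
        column a = proj₁ (complete (f a) (f-root a))

        column-signs : ∀ a → Σ (column a) ≡ signs qs (f a)
        column-signs a = proj₁ (proj₂ (complete (f a) (f-root a)))

        -- Every column that carries a realized sign vector is reached from an enumerated root, so
        -- its count is nonzero and the reduction keeps it.
        column-unique : ∀ x → Root p x → ∀ j → Σ j ≡ signs qs x → ∃[ a ] column a ≡ j
        column-unique x root j Σj≡ =
          let a , x≃fa = proj₂ (proj₂ (proj₂ roots)) x root
          in a , injective (trans (column-signs a) (sym (trans Σj≡ (signs-cong qs {x} {f a} x≃fa))))

        -- Only columns reached from a root contribute, and there `complete` identifies the entries
        -- of M with signs; in every other column `fiberSize` is 0.
        tarskiQueries : ∀ i →
          tarskiQuery em p (subproduct qs (S i)) / 1 ≡ (M *ᵥ fiberSize column) i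
        tarskiQueries i = trans (tarskiQuery-sum em p (subproduct qs (S i)) roots)
          (trans (∑-cong λ a → sym (proj₂ (proj₂ (complete (f a) (f-root a))) i))
            (∑-fibers (M i) column))

        -- In use, M′ and v are the matrix and the vector obtained by unfolding the
        -- algorithm; they are compared with M and the Tarski queries only entrywise.
        solution≗fiberSize : {w : Vector ℚ c} {M′ : Matrix r c} {v : Vector ℚ r} →
          (∀ j → w j ≡ solveLinear em default M′ v j) → (∀ i j → M′ i j ≡ M i j) →
          (∀ i → v i ≡ tarskiQuery em p (subproduct qs (S i)) / 1) →
          ∀ j → w j ≡ fiberSize column j
        solution≗fiberSize {w} {M′} {v} w≗ M′≈M v≗ j = trans (w≗ j)
          (solveLinear-correct em default M′ M′-invertible (λ i → trans (v≗ i)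
            (trans (tarskiQueries i) (∑-cong λ k → cong (_* fiberSize column k) (sym (M′≈M i k))))) j)
          where
          M′-invertible : ∃ (SquareWithInverse M′)
          M′-invertible = let B , r≡c , MB≈1 , BM≈1 = invertible in B , r≡c ,
            (λ i j → trans (∑-cong λ k → cong (_* B k j) (M′≈M i k)) (MB≈1 i j)) ,
            (λ i j → trans (∑-cong λ k → cong (B i k *_) (M′≈M k j)) (BM≈1 i j))

        -- The equation between the lists absorbs the difference between a list and the
        -- concatenation of its two halves, on which the reduction operates.
        nonzeros-exact : ∀ {qs′} → qs ≡ qs′ →
          {w : Vector ℚ c} → (∀ j → w j ≡ fiberSize column j) →
          let A = λ i k → M i (lookup (nonzeros w) k)
              R = pivots (rref em (transpose A))
          in Exact qs′ (mkSignData (A ∘ lookup R) (S ∘ lookup R) (Σ ∘ lookup (nonzeros w)))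
        nonzeros-exact refl {w} w≗size = select-exact qs (nonzeros w) adq
          (lookup-injective (unique-filter⁺ w≢0? (unique-allFin⁺ c)))
          (λ k → let a , eq = fiberSize≢0⇒∃ column (lookup (nonzeros w) k) (size≢0 k) in
            f a , f-root a , trans (cong Σ eq) (column-signs a))
          λ x root j Σj≡ →
            let a , column≡j = column-unique x root j Σj≡
                j∈nonzeros   = ∈-filter⁺ w≢0? (∈-allFin j) λ wj≡0 → fiberSize≢0 column a
                  (trans (cong (fiberSize column) column≡j) (trans (sym (w≗size j)) wj≡0))
            in index j∈nonzeros , sym (lookup-index j∈nonzeros)
          where
          w≢0? : ∀ j → Dec (w j ≢ 0ℚ)
          w≢0? j = ¬? (w j ≟ 0ℚ)

          size≢0 : ∀ k → fiberSize column (lookup (nonzeros w) k) ≢ 0ℚ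
          size≢0 k size≡0 =
            proj₂ (∈-filter⁻ w≢0? {xs = allFin c} (∈-lookup {xs = nonzeros w} k))
              (trans (w≗size (lookup (nonzeros w) k)) size≡0)

      reduce-exact : ∀ qd → Adequate (proj₁ qd) (proj₂ qd) →
                     Exact (proj₁ qd) (reduce em default p qd)
      reduce-exact (qs , mkSignData M S Σ) adq = nonzeros-exact qs adq refl
        (solution≗fiberSize qs adq (λ _ → refl) (λ _ _ → refl) (λ _ → refl))

-- In apply {B = …} f x, the type of f is unified with A → B before x is checked; below
-- this finds the solution w computed by the algorithm before facts about w are proved.
apply : {A B : Set} → (A → B) → A → B
apply f x = f x

-- Excluded middle has an explicit argument here and is passed on as λ {P} → lem P:
-- a hidden function passed by name is η-expanded in some places but not in others,
-- and unfoldings of reduce that are not syntactically equal are too large to compare.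
module _ (lem : (P : Set) → Dec P) (default : ∀ n → Vector ℚ n) (p : Poly)
         {N : ℕ} (roots : IsCardinality (Root p) N) where

  -- Lists of length at least 2 have two nonempty halves, so the recursion never enters the empty
  -- case with its auxiliary polynomial 1.
  calcDataAcc-exact : ∀ qs → 0 ℕ.< length qs → (rec : Acc ℕ._<_ (length qs)) →
    All (λ q → ∀ x → Root p x → ¬ eval q x ≃ 0ᵣ) qs →
    Exact (λ {P} → lem P) default p qs (calcDataAcc (λ {P} → lem P) default p qs rec)
  calcDataAcc-exact (q ∷ []) _ rec (q≄0 ∷ []) =
    reduce-exact (λ {P} → lem P) default p roots (q ∷ [] , base) (base-adequate (λ {P} → lem P) default p q q≄0)
  calcDataAcc-exact qs@(q₁ ∷ q₂ ∷ qs′) _ rec@(acc rs) qs≄0 =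
    apply {B = Exact (λ {P} → lem P) default p qs (calcDataAcc (λ {P} → lem P) default p qs rec)}
      (nonzeros-exact (λ {P} → lem P) default p roots (qs₁ ++ qs₂) adq (Listₚ.take++drop≡id h qs))
        (solution≗fiberSize (λ {P} → lem P) default p roots (qs₁ ++ qs₂) adq
          (λ _ → refl) (λ _ _ → refl) (λ _ → refl))
    where
    h : ℕ
    h = ⌊ length qs /2⌋

    qs₁ qs₂ : List Poly
    qs₁ = take h qs
    qs₂ = drop h qs

    0<length-drop : 0 ℕ.< length qs₂
    0<length-drop = subst (0 ℕ.<_) (sym (Listₚ.length-drop h qs))
      (ℕₚ.m<n⇒0<n∸m (ℕₚ.⌊n/2⌋<n (suc (length qs′))))

    -- These two proofs occur in the recursive calls, so they repeat those of calcDataAcc.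
    qs₁<qs : length qs₁ ℕ.< length qs
    qs₁<qs = ℕₚ.≤-<-trans
      (ℕₚ.≤-trans (ℕₚ.≤-reflexive (Listₚ.length-take h qs)) (ℕₚ.m⊓n≤m h (length qs)))
      (ℕₚ.⌊n/2⌋<n (suc (length qs′)))

    qs₂<qs : length qs₂ ℕ.< length qs
    qs₂<qs = subst (ℕ._< length qs) (sym (Listₚ.length-drop h qs))
      (ℕₚ.∸-monoʳ-< {length qs} {h} {0} (ℕ.s≤s ℕ.z≤n)
        (ℕₚ.<⇒≤ (ℕₚ.⌊n/2⌋<n (suc (length qs′)))))

    d₁ d₂ : SignData
    d₁ = calcDataAcc (λ {P} → lem P) default p (take h qs) (rs qs₁<qs)
    d₂ = calcDataAcc (λ {P} → lem P) default p (drop h qs) (rs qs₂<qs)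

    open SignData (proj₂ (combine (qs₁ , d₁) (qs₂ , d₂)))

    adq : Adequate (λ {P} → lem P) default p (qs₁ ++ qs₂) (mkSignData M S Σ)
    adq = combine-adequate (λ {P} → lem P) default p qs₁ d₁ qs₂ d₂
      (calcDataAcc-exact qs₁ (ℕ.s≤s ℕ.z≤n) (rs qs₁<qs) (Allₚ.take⁺ h qs≄0))
      (calcDataAcc-exact qs₂ 0<length-drop (rs qs₂<qs) (Allₚ.drop⁺ h qs≄0))

module _ (em : ExcludedMiddle 0ℓ) (default : ∀ n → Vector ℚ n) (p : Poly)
         {N : ℕ} (roots : IsCardinality (Root p) N) where

  -- For the empty list the reduction is exact for `[ 1ₚ ]`. Dropping the sign of 1 leaves the empty
  -- vector, which is listed exactly when p has a root.
  calcData-signs : ∀ qs → All (λ q → ∀ x → Root p x → ¬ eval q x ≃ 0ᵣ) qs → ∀ σ →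
    σ ∈ findConsistentSignsAtRoots em default p qs ⇔ (∃[ x ] Root p x × σ ≡ signs em qs x)
  calcData-signs [] _ σ = mk⇔
    (λ σ∈ → let j , σ≡     = ∈-tabulate⁻ σ∈
                x , root , Σ≡ = realized j
            in x , root , trans σ≡ (cong (drop 1) Σ≡))
    (λ (x , root , σ≡) → let j , Σ≡ , _ = complete x root in
      subst (_∈ _) (trans (cong (drop 1) Σ≡) (sym σ≡)) (∈-tabulate⁺ {f = drop 1 ∘ Σ} j))
    where
    d : SignData
    d = reduce em default p ([ 1ₚ ] , base)

    open SignData d

    1≄0 : ∀ x → ¬ eval 1ₚ x ≃ 0ᵣ
    1≄0 x 1≃0 = <ᵣ-irrefl {0ᵣ} {eval 1ₚ x} (≃-sym {eval 1ₚ x} {0ᵣ} 1≃0)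
      (<ᵣ-respʳ-≃ {0ᵣ} {1ᵣ} {eval 1ₚ x} 0<1ᵣ
        (≃-sym {eval 1ₚ x} {1ᵣ} (≐⇒≃ {eval 1ₚ x} {1ᵣ} (eval-1ₚ x))))

    open Exact {em} {default} {p}
      (reduce-exact em default p roots ([ 1ₚ ] , base) (base-adequate em default p 1ₚ λ x _ → 1≄0 x))
  calcData-signs qs@(_ ∷ _) qs≄0 σ = mk⇔
    (λ σ∈ → let j , σ≡        = ∈-tabulate⁻ σ∈
                x , root , Σ≡ = realized j
            in x , root , trans σ≡ Σ≡)
    (λ (x , root , σ≡) → let j , Σ≡ , _ = complete x root in
      subst (_∈ _) (trans Σ≡ (sym σ≡)) (∈-tabulate⁺ j))
    where
    open Exact {em} {default} {p}
      (calcDataAcc-exact (λ P → em {P}) default p roots qs (ℕ.s≤s ℕ.z≤n) (<-wellFounded (length qs)) qs≄0)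

mainTheorem2 :
    (em : ExcludedMiddle 0ℓ) (default : (n : ℕ) → Vector ℚ n) →
    (p : Poly) (qs : List Poly) →
    ¬ (p ≈ₚ 0ₚ) →
    All (λ q → Coprime p q) qs →
    (σ : SignVector) →
    σ ∈ findConsistentSignsAtRoots em default p qs ⇔
    (∃[ x ] (eval p x ≃ 0ᵣ) × (σ ≡ map (λ q → sgn em (eval q x)) qs))
mainTheorem2 em default p qs p≉0 coprime =
  calcData-signs em default p (proj₂ (finitely-many-roots em p p≉0)) qs
    (All.map (λ {q} → coprime⇒no-common-root p q) coprime)
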